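{- Let $n \ge 1$ be an integer. If $n$ is even, then $$\max_{M \in \mathcal{S}_n} C_3(M) = \frac{1}{4}\binom{n}{3}.$$ If $n$ is odd, then $$2\binom{\frac{n+1}{2}}{3} \le \max_{M \in \mathcal{S}_n} C_3(M) \le \frac{1}{4}\binom{n}{3}.$$
   Context: A tournament matrix of order $n$ is an $n \times n$ $(0,1)$-matrix $M$ with $M + M^T = J_n - I_n$, where $J_n$ is the all-ones matrix and $I_n$ the identity; it is the adjacency matrix of a tournament (an orientation of the complete graph on $n$ vertices). $\mathcal{S}_n$ denotes the set of singular tournament matrices of order $n$ (singularity over the real/complex numbers). $C_3(M)$ is the number of directed $3$-cycles in the tournament with adjacency matrix $M$, counted as $3$-vertex subsets inducing a directed cycle. Binomial coefficients $\binom{a}{3}$ with $0\le a<3$ are $0$. -}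

module Defs where

open import Data.Bool.Base using (if_then_else_)
open import Data.Fin.Base using (Fin; zero; suc; toℕ; punchIn; _<_)
open import Data.Fin.Properties using (_≟_; _<?_)
open import Data.Integer.Base using (ℤ; 0ℤ; 1ℤ; -1ℤ; _+_; _-_; _*_; _^_)
open import Data.Integer.Properties using (+-*-semiring) renaming (_≟_ to _≟ℤ_)
open import Data.List.Base using (List; length; filter; cartesianProduct; allFin)
open import Data.Nat.Base using (ℕ; zero; suc) renaming (_≤_ to _≤ℕ_)
open import Data.Product.Base using (_×_; _,_; ∃-syntax)
open import Data.Sum.Base using (_⊎_)
open import Relation.Binary.PropositionalEquality.Core using (_≡_)
open import Relation.Nullary.Decidable using (Dec; does; _×-dec_; _⊎-dec_)
open import Relation.Unary using (Decidable)

open import Algebra.Properties.Semiring.Sum +-*-semiring using (sum)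

Matrix : ℕ → Set
Matrix n = Fin n → Fin n → ℤ

J : ∀ n → Matrix n
J n i j = 1ℤ

I : ∀ n → Matrix n
I n i j = if does (i ≟ j) then 1ℤ else 0ℤ

minor : ∀ {n} → Fin (suc n) → Fin (suc n) → Matrix (suc n) → Matrix n
minor i j M k l = M (punchIn i k) (punchIn j l)

-- Laplace expansion along the first row.
det : ∀ {n} → Matrix n → ℤ
det {zero}  M = 1ℤ
det {suc n} M = sum λ j → -1ℤ ^ toℕ j * M zero j * det (minor zero j M)

-- The determinant is an integer polynomial in the entries and ℤ embeds in ℝ
-- and ℂ, so vanishing in ℤ is exactly singularity over ℝ or ℂ.
Singular : ∀ {n} → Matrix n → Set
Singular M = det M ≡ 0ℤ

record IsTournament {n : ℕ} (M : Matrix n) : Set where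
  field
    zero-one    : ∀ i j → M i j ≡ 0ℤ ⊎ M i j ≡ 1ℤ
    M+Mᵀ≡J-I    : ∀ i j → M i j + M j i ≡ J n i j - I n i j

𝒮 : ∀ n → Matrix n → Set
𝒮 n M = IsTournament M × Singular M

Arc : ∀ {n} → Matrix n → Fin n → Fin n → Set
Arc M i j = M i j ≡ 1ℤ

arc? : ∀ {n} (M : Matrix n) i j → Dec (Arc M i j)
arc? M i j = M i j ≟ℤ 1ℤ

DirectedCycle : ∀ {n} → Matrix n → Fin n → Fin n → Fin n → Set
DirectedCycle M i j k = Arc M i j × Arc M j k × Arc M k i

directedCycle? : ∀ {n} (M : Matrix n) i j k → Dec (DirectedCycle M i j k)
directedCycle? M i j k = arc? M i j ×-dec arc? M j k ×-dec arc? M k i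

Triple : ℕ → Set
Triple n = Fin n × Fin n × Fin n

-- A 3-vertex subset is represented by its increasing enumeration i < j < k;
-- the two disjuncts are the two possible cyclic orientations.
CyclicTriple : ∀ {n} → Matrix n → Triple n → Set
CyclicTriple M (i , j , k) =
  (i < j × j < k) × (DirectedCycle M i j k ⊎ DirectedCycle M i k j)

cyclicTriple? : ∀ {n} (M : Matrix n) → Decidable (CyclicTriple M)
cyclicTriple? M (i , j , k) =
  (i <? j ×-dec j <? k) ×-dec (directedCycle? M i j k ⊎-dec directedCycle? M i k j)

allTriples : ∀ n → List (Triple n)
allTriples n = cartesianProduct (allFin n) (cartesianProduct (allFin n) (allFin n))

C₃ : ∀ {n} → Matrix n → ℕ
C₃ {n} M = length (filter (cyclicTriple? M) (allTriples n))

-- m = max { C₃ M ∣ M ∈ 𝒮 n }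
IsMaxC₃ : ℕ → ℕ → Set
IsMaxC₃ n m = (∃[ M ] 𝒮 n M × C₃ M ≡ m) × (∀ M → 𝒮 n M → C₃ M ≤ℕ m)

{-# OPTIONS --safe #-}

-- Upper bound.  Counting paths and forks expresses C₃ through the scores sᵢ:
-- 12 C₃ = n(n−1)(2n−1) − 6 Σ sᵢ².  If yᵀM = 0 with y ≠ 0 and e = Σ yᵢ, then
-- y ⊥ s, and yᵀ(M + Mᵀ)y = 0 gives Σ yᵢ² = e², so e ≠ 0.  Now Cauchy–Schwarz,
-- in the form Σ (2e sᵢ + n yᵢ − e n)² = e² (4 Σ sᵢ² − n²(n−1)) ≥ 0, bounds
-- Σ sᵢ² from below.
--
-- Lower bound.  A sink makes the matrix singular; adding it to a tournament on
-- n−1 vertices with scores as equal as possible attains the upper bound for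
-- even n and 2·C((n+1)/2, 3) for odd n.

module Submission where

open import Defs
open import Data.Bool.Base using (true; false; if_then_else_)
open import Data.Empty using (⊥-elim)
open import Data.Fin.Base using (Fin; zero; suc; toℕ; punchIn; punchOut; finToFun; funToFin)
open import Data.Fin.Properties using (_≟_; _<?_; <-trans; <-asym; <-cmp; all?; any?; punchInᵢ≢i; punchIn-punchOut; finToFun-funToFin)
open import Data.Integer.Base as ℤ using (ℤ; +_; 0ℤ; 1ℤ)
import Data.Integer.Properties as ℤ
open import Data.Integer.Tactic.RingSolver using (solve-∀)
open import Data.List.Base using (List; []; _∷_; _++_; length; filter; map; tabulate; allFin; cartesianProduct)
open import Data.List.Properties using (filter-++; filter-≐; length-++; length-filter)
open import Data.Nat.Base as ℕ using (ℕ; zero; suc)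
import Data.Nat.Properties as ℕ
open import Data.Product.Base using (_×_; _,_; proj₁; ∃-syntax; Σ-syntax)
open import Data.Sum.Base as Sum using (_⊎_; inj₁; inj₂; reduce)
open import Function.Base using (_∘_)
open import Relation.Binary.Definitions using (tri<; tri≈; tri>)
open import Relation.Binary.PropositionalEquality
open import Relation.Nullary.Decidable using (Dec; yes; no; does; ¬?; _×-dec_; _⊎-dec_; map′; dec-true; dec-false; decidable-stable)
open import Relation.Nullary.Negation.Core using (¬_)
open import Relation.Unary using (Decidable)

open import Algebra.Properties.Semiring.Sum ℤ.+-*-semiring
  using (sum; sum-cong-≗; sum-remove; sum-replicate-zero; ∑-distrib-+; ∑-comm; *-distribˡ-sum; *-distribʳ-sum)

open ≡-Reasoning

-- Where the square comes from: put cᵢ = sᵢ - (n-1)/2 and zᵢ = yᵢ - e/n. Then ⟨c, z⟩ = -(n-1)e/2 and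
-- ‖z‖² = e²(n-1)/n, so Cauchy-Schwarz gives ‖c‖² ≥ n(n-1)/4. Equality means 2e·c + n·z = 0, and the
-- left side is exactly the vector 2e·s + n·y - e·n. This also explains the sink. Its indicator
-- vector is a left kernel vector with e = 1, and equality then asks every other vertex to have
-- score n/2, that is, the tournament on the remaining n-1 vertices to be regular. For odd n the
-- number n/2 is not an integer, so this construction falls short of the bound. Two obstacles take
-- up much of the text. Singularity is given as a vanishing Laplace expansion over ℤ, so the integer
-- vector y has to be extracted from it without division. And the maximum must be shown to exist
-- constructively, which calls for a finite search through 0-1 matrices. All inequalities are
-- multiplied out over ℤ; fractions appear only in the final statement.

module Determinants where

  open import Data.Integer.Base using (-1ℤ; _+_; _*_; -_; _^_)
  open import Data.Integer.Properties using (*-zeroˡ; *-zeroʳ; *-identityˡ; +-identityʳ;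
    i*j≡0⇒i≡0∨j≡0)

  -- Finite sums, and the determinant as an alternating multilinear function of the rows.

  sum-zero : ∀ {n} {f : Fin n → ℤ} → (∀ i → f i ≡ 0ℤ) → sum f ≡ 0ℤ
  sum-zero {n} f≗0 = trans (sum-cong-≗ f≗0) (sum-replicate-zero n)

  sum-single : ∀ {n} {f : Fin n → ℤ} p → (∀ i → i ≢ p → f i ≡ 0ℤ) → sum f ≡ f p
  sum-single {suc n} {f} p f≗0 = begin
    sum f                            ≡⟨ sum-remove {i = p} f ⟩
    f p + sum (f ∘ punchIn p)        ≡⟨ cong (_+_ (f p)) (sum-zero (λ i → f≗0 (punchIn p i) (punchInᵢ≢i p i))) ⟩
    f p + 0ℤ                         ≡⟨ +-identityʳ (f p) ⟩
    f p                              ∎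

  sum-linear : ∀ {n} a b (f g : Fin n → ℤ) →
               sum (λ i → a * f i + b * g i) ≡ a * sum f + b * sum g
  sum-linear a b f g = begin
    sum (λ i → a * f i + b * g i)             ≡⟨ ∑-distrib-+ (λ i → a * f i) (λ i → b * g i) ⟩
    sum (λ i → a * f i) + sum (λ i → b * g i) ≡⟨ cong₂ _+_ (*-distribˡ-sum a f) (*-distribˡ-sum b g) ⟨
    a * sum f + b * sum g                     ∎

  sgn : ∀ {n} → Fin n → ℤ
  sgn i = -1ℤ ^ toℕ i

  det-cong : ∀ {n} {M N : Matrix n} → (∀ i j → M i j ≡ N i j) → det M ≡ det N
  det-cong {zero}  M≗N = refl
  det-cong {suc n} M≗N = sum-cong-≗ λ j →
    cong₂ (λ x y → sgn j * x * y) (M≗N zero j) (det-cong λ k l → M≗N (suc k) (punchIn j l))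

  -- The two ways (j, k) and (j′, k′) of removing the same two columns one after
  -- the other, k and k′ being positions among the columns left by the first step.
  data Crossing : ∀ {n} → Fin (suc n) → Fin n → Fin (suc n) → Fin n → Set where
    base : ∀ {n} (k : Fin (suc n)) → Crossing zero k (suc k) zero
    step : ∀ {n} {j : Fin (suc n)} {k j′ k′} →
           Crossing j k j′ k′ → Crossing (suc j) (suc k) (suc j′) (suc k′)

  crossing-left : ∀ {n j k j′ k′} → Crossing {n} j k j′ k′ → punchIn j k ≡ j′
  crossing-left (base k) = refl
  crossing-left (step c) = cong suc (crossing-left c)

  crossing-right : ∀ {n j k j′ k′} → Crossing {n} j k j′ k′ → punchIn j′ k′ ≡ j
  crossing-right (base k) = refl
  crossing-right (step c) = cong suc (crossing-right c)

  crossing-rest : ∀ {n j k j′ k′} → Crossing {suc n} j k j′ k′ →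
                  ∀ l → punchIn j (punchIn k l) ≡ punchIn j′ (punchIn k′ l)
  crossing-rest (base k) l       = refl
  crossing-rest {suc n} (step c) zero    = refl
  crossing-rest {suc n} (step c) (suc l) = cong suc (crossing-rest c l)

  -- The signed sum produced by a Laplace expansion along two rows, with the summand left abstract
  -- so that an induction can shift both column indices.
  alternating : ∀ {n} → (Fin (suc n) → Fin n → ℤ) → ℤ
  alternating {n} G = sum λ j → sum λ k → sgn j * sgn k * G j k

  -- The index pairs split into j = 0, then j positive with k = 0, then both positive. The shifted j
  -- makes the second block negative; in the third the two shifts cancel.
  alternating-suc : ∀ {n} (G : Fin (suc (suc n)) → Fin (suc n) → ℤ) →
    alternating G ≡ sum (λ k → sgn k * G zero k)
                  + (- sum (λ k → sgn k * G (suc k) zero)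
                     + alternating (λ j k → G (suc j) (suc k)))
  alternating-suc {n} G = cong₂ _+_
    (sum-cong-≗ λ k → cong (_* G zero k) (*-identityˡ (sgn k)))
    (begin
      sum (λ j → sgn (suc j) * 1ℤ * G (suc j) zero + rest j)
        ≡⟨ sum-cong-≗ (λ j → cong₂ _+_ (lemma₁ (sgn j) (G (suc j) zero))
             (trans (sum-cong-≗ λ k → lemma₂ (sgn j) (sgn k) (G (suc j) (suc k)))
                    (sym (*-identityˡ (inner j))))) ⟩
      sum (λ j → -1ℤ * (sgn j * G (suc j) zero) + 1ℤ * inner j)
        ≡⟨ sum-linear -1ℤ 1ℤ (λ j → sgn j * G (suc j) zero) inner ⟩
      -1ℤ * sum (λ j → sgn j * G (suc j) zero) + 1ℤ * sum inner
        ≡⟨ lemma₃ (sum λ j → sgn j * G (suc j) zero) (sum inner) ⟩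
      - sum (λ j → sgn j * G (suc j) zero) + sum inner ∎)
    where
    rest inner : Fin (suc n) → ℤ
    rest j  = sum (λ k → sgn (suc j) * sgn (suc k) * G (suc j) (suc k))
    inner j = sum (λ k → sgn j * sgn k * G (suc j) (suc k))
    lemma₁ : ∀ s g → -1ℤ * s * 1ℤ * g ≡ -1ℤ * (s * g)
    lemma₁ = solve-∀
    lemma₂ : ∀ s t g → (-1ℤ * s) * (-1ℤ * t) * g ≡ s * t * g
    lemma₂ = solve-∀
    lemma₃ : ∀ x y → -1ℤ * x + 1ℤ * y ≡ - x + y
    lemma₃ = solve-∀

  -- The two pairs of a `Crossing` carry opposite signs: in `base` the sign exponents k and k + 1
  -- differ by one, and `step` adds two to both. A `Crossing` always lists the pair with j < j′
  -- first, so the first hypothesis treats the pairs that remove the left column first and the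
  -- second treats the others.
  alternating-swap : ∀ {n} (G H : Fin (suc n) → Fin n → ℤ) →
    (∀ {j k j′ k′} → Crossing j k j′ k′ → G j k ≡ H j′ k′) →
    (∀ {j k j′ k′} → Crossing j k j′ k′ → G j′ k′ ≡ H j k) →
    alternating G ≡ - alternating H
  alternating-swap {zero}  G H _ _ = refl
  alternating-swap {suc n} G H G≗H G≗H′ = begin
    alternating G                  ≡⟨ alternating-suc G ⟩
    row G + (- col G + inner G)
      ≡⟨ cong₂ _+_ (sum-cong-≗ λ k → cong (sgn k *_) (G≗H (base k)))
           (cong₂ (λ x y → - x + y) (sum-cong-≗ λ k → cong (sgn k *_) (G≗H′ (base k)))
             (alternating-swap _ _ (λ c → G≗H (step c)) (λ c → G≗H′ (step c)))) ⟩
    col H + (- row H + - inner H)  ≡⟨ lemma (row H) (col H) (inner H) ⟩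
    - (row H + (- col H + inner H)) ≡⟨ cong -_ (alternating-suc H) ⟨
    - alternating H                ∎
    where
    row col inner : (Fin (suc (suc n)) → Fin (suc n) → ℤ) → ℤ
    row F = sum (λ k → sgn k * F zero k)
    col F = sum (λ k → sgn k * F (suc k) zero)
    inner F = alternating (λ j k → F (suc j) (suc k))
    lemma : ∀ r c i → c + (- r + - i) ≡ - (r + (- c + i))
    lemma = solve-∀

  swap₀₁ : ∀ {n} → Matrix (suc (suc n)) → Matrix (suc (suc n))
  swap₀₁ M zero          = M (suc zero)
  swap₀₁ M (suc zero)    = M zero
  swap₀₁ M (suc (suc i)) = M (suc (suc i))

  doubleMinor : ∀ {n} → Matrix (suc (suc n)) → Fin (suc (suc n)) → Fin (suc n) → Matrix n
  doubleMinor M j k = minor zero k (minor zero j M)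

  laplace₂ : ∀ {n} → Matrix (suc (suc n)) → Fin (suc (suc n)) → Fin (suc n) → ℤ
  laplace₂ M j k = M zero j * M (suc zero) (punchIn j k) * det (doubleMinor M j k)

  det-laplace₂ : ∀ {n} (M : Matrix (suc (suc n))) → det M ≡ alternating (laplace₂ M)
  det-laplace₂ M = sum-cong-≗ λ j → trans (*-distribˡ-sum (sgn j * M zero j) (terms j))
    (sum-cong-≗ λ k → lemma (sgn j) (M zero j) (sgn k) (M (suc zero) (punchIn j k)) (det (doubleMinor M j k)))
    where
    terms : ∀ j k → ℤ
    terms j k = sgn k * M (suc zero) (punchIn j k) * det (doubleMinor M j k)
    lemma : ∀ s x t y d → s * x * (t * y * d) ≡ s * t * (x * y * d)
    lemma = solve-∀

  det-swap₀₁ : ∀ {n} (M : Matrix (suc (suc n))) → det M ≡ - det (swap₀₁ M)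
  det-swap₀₁ M = begin
    det M                              ≡⟨ det-laplace₂ M ⟩
    alternating (laplace₂ M)           ≡⟨ alternating-swap _ _ swap swap′ ⟩
    - alternating (laplace₂ (swap₀₁ M)) ≡⟨ cong -_ (det-laplace₂ (swap₀₁ M)) ⟨
    - det (swap₀₁ M)                   ∎
    where
    lemma : ∀ x y d → x * y * d ≡ y * x * d
    lemma = solve-∀
    minors : ∀ {j k j′ k′} → Crossing j k j′ k′ →
             det (doubleMinor M j k) ≡ det (doubleMinor M j′ k′)
    minors c = det-cong λ a b → cong (M (suc (suc a))) (crossing-rest c b)
    swap : ∀ {j k j′ k′} → Crossing j k j′ k′ → laplace₂ M j k ≡ laplace₂ (swap₀₁ M) j′ k′
    swap {j} {k} {j′} {k′} c
      rewrite crossing-left c | crossing-right c | minors c =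
      lemma (M zero j) (M (suc zero) j′) _
    swap′ : ∀ {j k j′ k′} → Crossing j k j′ k′ → laplace₂ M j′ k′ ≡ laplace₂ (swap₀₁ M) j k
    swap′ {j} {k} {j′} {k′} c
      rewrite crossing-left c | crossing-right c | minors c =
      lemma (M zero j′) (M (suc zero) j) _

  -- Turns antisymmetry under a row swap into vanishing for two equal rows.
  self-negative⇒0 : ∀ i → i ≡ - i → i ≡ 0ℤ
  self-negative⇒0 (+ zero) _ = refl

  det-equal₀₁ : ∀ {n} (M : Matrix (suc (suc n))) → (∀ j → M zero j ≡ M (suc zero) j) → det M ≡ 0ℤ
  det-equal₀₁ M eq = self-negative⇒0 (det M) (trans (det-swap₀₁ M) (cong -_ (det-cong same)))
    where
    same : ∀ i j → swap₀₁ M i j ≡ M i j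
    same zero          j = sym (eq j)
    same (suc zero)    j = eq j
    same (suc (suc i)) j = refl

  cons : ∀ {n} → (Fin (suc n) → ℤ) → (Fin n → Fin (suc n) → ℤ) → Matrix (suc n)
  cons v R zero    = v
  cons v R (suc i) = R i

  det-row₀-linear : ∀ {n} a b (v w : Fin (suc n) → ℤ) R →
    det (cons (λ j → a * v j + b * w j) R) ≡ a * det (cons v R) + b * det (cons w R)
  det-row₀-linear a b v w R = trans
    (sum-cong-≗ λ j → lemma (sgn j) a b (v j) (w j) (det (λ k l → R k (punchIn j l))))
    (sum-linear a b (term v) (term w))
    where
    term : (Fin _ → ℤ) → Fin _ → ℤ
    term u j = sgn j * u j * det (λ k l → R k (punchIn j l))
    lemma : ∀ s a b x y d → s * (a * x + b * y) * d ≡ a * (s * x * d) + b * (s * y * d)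
    lemma = solve-∀

  eliminate : ∀ {n} → ℤ → (Fin n → ℤ) → Matrix (suc n) → Matrix (suc n)
  eliminate a b M zero    j = M zero j
  eliminate a b M (suc i) j = a * M (suc i) j + b i * M zero j

  -- After swapping rows 0 and 1 the old row 0 heads every minor of the Laplace
  -- expansion, so the remaining rows are handled by the induction hypothesis.
  det-eliminate : ∀ {n} a (b : Fin n → ℤ) (M : Matrix (suc n)) →
                  det (eliminate a b M) ≡ a ^ n * det M
  det-eliminate {zero}  a b M = sym (*-identityˡ (det M))
  det-eliminate {suc n} a b M = begin
    det (eliminate a b M)          ≡⟨ det-swap₀₁ (eliminate a b M) ⟩
    - det (swap₀₁ (eliminate a b M))
      ≡⟨ cong -_ (sum-cong-≗ λ j → trans (cong (sgn j * r₁ j *_) (trans (det-cong (inner j)) (det-eliminate a (b ∘ suc) (minor zero j N))))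
                                         (lemma₁ (sgn j * r₁ j) (a ^ n) _)) ⟩
    - sum (λ j → a ^ n * (sgn j * r₁ j * det (minor zero j N)))
      ≡⟨ cong -_ (*-distribˡ-sum (a ^ n) (λ j → sgn j * r₁ j * det (minor zero j N))) ⟨
    - (a ^ n * det (cons r₁ R))
      ≡⟨ cong (λ x → - (a ^ n * x)) (det-row₀-linear a (b zero) (M (suc zero)) (M zero) R) ⟩
    - (a ^ n * (a * det (cons (M (suc zero)) R) + b zero * det (cons (M zero) R)))
      ≡⟨ cong₂ (λ x y → - (a ^ n * (a * x + b zero * y)))
           (det-cong same) (det-equal₀₁ (cons (M zero) R) (λ _ → refl)) ⟩
    - (a ^ n * (a * det (swap₀₁ M) + b zero * 0ℤ))
      ≡⟨ lemma₂ (a ^ n) a (det (swap₀₁ M)) (b zero) ⟩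
    a ^ suc n * - det (swap₀₁ M)   ≡⟨ cong (a ^ suc n *_) (det-swap₀₁ M) ⟨
    a ^ suc n * det M              ∎
    where
    r₁ : Fin (suc (suc n)) → ℤ
    r₁ = eliminate a b M (suc zero)
    R : Fin (suc n) → Fin (suc (suc n)) → ℤ
    R zero    = M zero
    R (suc i) = M (suc (suc i))
    N : Matrix (suc (suc n))
    N = cons r₁ R
    inner : ∀ j k l → minor zero j (swap₀₁ (eliminate a b M)) k l
                    ≡ eliminate a (b ∘ suc) (minor zero j N) k l
    inner j zero    l = refl
    inner j (suc k) l = refl
    same : ∀ i j → cons (M (suc zero)) R i j ≡ swap₀₁ M i j
    same zero          j = refl
    same (suc zero)    j = refl
    same (suc (suc i)) j = refl
    lemma₁ : ∀ s p d → s * (p * d) ≡ p * (s * d)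
    lemma₁ = solve-∀
    lemma₂ : ∀ p a d c → - (p * (a * d + c * 0ℤ)) ≡ a * p * - d
    lemma₂ = solve-∀

  -- Pivoting, and a left kernel vector from a vanishing determinant.

  det-zero-column : ∀ {n} {M : Matrix n} p → (∀ i → M i p ≡ 0ℤ) → det M ≡ 0ℤ
  det-zero-column {suc n} {M} p col≗0 = sum-zero term
    where
    term : ∀ j → sgn j * M zero j * det (minor zero j M) ≡ 0ℤ
    term j with j ≟ p
    ... | yes refl rewrite col≗0 zero | *-zeroʳ (sgn j) = refl
    ... | no j≢p = trans (cong (sgn j * M zero j *_) (det-zero-column {M = minor zero j M} (punchOut j≢p)
                     λ i → trans (cong (M (suc i)) (punchIn-punchOut j≢p)) (col≗0 (suc i))))
                     (*-zeroʳ (sgn j * M zero j))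

  -- Deleting a column other than `p` keeps column `p` in the minor, where it consists of zeros, so
  -- a single term of the expansion survives.
  det-pivot : ∀ {n} {M : Matrix (suc n)} p → (∀ i → M (suc i) p ≡ 0ℤ) →
              det M ≡ sgn p * M zero p * det (minor zero p M)
  det-pivot {M = M} p col≗0 = sum-single p λ j j≢p →
    trans (cong (sgn j * M zero j *_) (det-zero-column {M = minor zero j M} (punchOut j≢p)
            λ i → trans (cong (M (suc i)) (punchIn-punchOut j≢p)) (col≗0 i)))
          (*-zeroʳ (sgn j * M zero j))

  sgn*sgn≡1 : ∀ {n} (i : Fin n) → sgn i * sgn i ≡ 1ℤ
  sgn*sgn≡1 zero    = refl
  sgn*sgn≡1 (suc i) = trans (lemma (sgn i)) (sgn*sgn≡1 i)
    where
    lemma : ∀ s → (-1ℤ * s) * (-1ℤ * s) ≡ s * s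
    lemma = solve-∀

  *-cancel-0 : ∀ a {b} → a ≢ 0ℤ → a * b ≡ 0ℤ → b ≡ 0ℤ
  *-cancel-0 a a≢0 ab≡0 with i*j≡0⇒i≡0∨j≡0 a ab≡0
  ... | inj₁ a≡0 = ⊥-elim (a≢0 a≡0)
  ... | inj₂ b≡0 = b≡0

  -- The left kernel is the convenient side because scores are row sums: applying yᵀM = 0 to the
  -- all-ones vector gives y ⊥ s directly.
  LeftKernel : ∀ {n} → Matrix n → Set
  LeftKernel {n} M = Σ[ y ∈ (Fin n → ℤ) ] (∃[ i ] y i ≢ 0ℤ) × (∀ j → sum (λ i → y i * M i j) ≡ 0ℤ)

  -- Chio condensation: division-free, at the price of a factor M zero p per row.
  clear : ∀ {n} → Fin (suc n) → Matrix (suc n) → Matrix (suc n)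
  clear p M = eliminate (M zero p) (λ i → - M (suc i) p) M

  clear-column : ∀ {n} p (M : Matrix (suc n)) i → clear p M (suc i) p ≡ 0ℤ
  clear-column p M i = lemma (M zero p) (M (suc i) p)
    where
    lemma : ∀ a x → a * x + - x * a ≡ 0ℤ
    lemma = solve-∀

  -- Up to sign, pivot times condensed minor is the determinant of the cleared matrix, hence a power
  -- of the pivot times `det M`. The sign is removed by multiplying with `sgn p` once more.
  clear-singular : ∀ {n} p (M : Matrix (suc n)) → M zero p ≢ 0ℤ → Singular M →
                   Singular (minor zero p (clear p M))
  clear-singular {n} p M a≢0 det≡0 = *-cancel-0 a a≢0 (begin
    a * d                     ≡⟨ *-identityˡ (a * d) ⟨
    1ℤ * (a * d)              ≡⟨ cong (_* (a * d)) (sgn*sgn≡1 p) ⟨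
    sgn p * sgn p * (a * d)   ≡⟨ lemma₀ (sgn p) a d ⟩
    sgn p * (sgn p * a * d)   ≡⟨ cong (sgn p *_) (det-pivot {M = clear p M} p (clear-column p M)) ⟨
    sgn p * det (clear p M)   ≡⟨ cong (sgn p *_) (det-eliminate a (λ i → - M (suc i) p) M) ⟩
    sgn p * (a ^ n * det M)   ≡⟨ cong (λ x → sgn p * (a ^ n * x)) det≡0 ⟩
    sgn p * (a ^ n * 0ℤ)      ≡⟨ lemma₁ (sgn p) (a ^ n) ⟩
    0ℤ                        ∎)
    where
    a = M zero p
    d = det (minor zero p (clear p M))
    lemma₀ : ∀ s a d → s * s * (a * d) ≡ s * (s * a * d)
    lemma₀ = solve-∀
    lemma₁ : ∀ s p → s * (p * 0ℤ) ≡ 0ℤ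
    lemma₁ = solve-∀

  -- Each condensed row is a combination of a row of `M` and the top row. Collecting the
  -- coefficients of `z` on these combinations gives `y`; it stays nonzero because the pivot does.
  clear-leftKernel : ∀ {n} p (M : Matrix (suc n)) → M zero p ≢ 0ℤ →
                     LeftKernel (minor zero p (clear p M)) → LeftKernel M
  clear-leftKernel {n} p M a≢0 (z , (i , zᵢ≢0) , ker) =
    y , (suc i , λ azᵢ≡0 → zᵢ≢0 (*-cancel-0 (M zero p) a≢0 azᵢ≡0)) , kernel
    where
    y : Fin (suc n) → ℤ
    y zero    = sum (λ i → z i * - M (suc i) p)
    y (suc i) = M zero p * z i
    lemma : ∀ z b m₀ a m → z * b * m₀ + a * z * m ≡ z * (a * m + b * m₀)
    lemma = solve-∀
    columns : ∀ j → sum (λ i → z i * clear p M (suc i) j) ≡ 0ℤ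
    columns j with p ≟ j
    -- Column `p` is missing from the minor, so `ker` says nothing about it; clearing has already
    -- made it zero.
    ... | yes refl = sum-zero λ i → trans (cong (z i *_) (clear-column p M i)) (*-zeroʳ (z i))
    ... | no p≢j   = trans
      (sum-cong-≗ λ i → cong (λ k → z i * clear p M (suc i) k) (sym (punchIn-punchOut p≢j)))
      (ker (punchOut p≢j))
    kernel : ∀ j → sum (λ i → y i * M i j) ≡ 0ℤ
    kernel j = begin
      y zero * M zero j + sum (λ i → M zero p * z i * M (suc i) j)
        ≡⟨ cong (_+ sum (λ i → M zero p * z i * M (suc i) j)) (*-distribʳ-sum (M zero j) (λ i → z i * - M (suc i) p)) ⟩
      sum (λ i → z i * - M (suc i) p * M zero j) + sum (λ i → M zero p * z i * M (suc i) j)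
        ≡⟨ ∑-distrib-+ (λ i → z i * - M (suc i) p * M zero j)
                      (λ i → M zero p * z i * M (suc i) j) ⟨
      sum (λ i → z i * - M (suc i) p * M zero j + M zero p * z i * M (suc i) j)
        ≡⟨ sum-cong-≗ (λ i → lemma (z i) (- M (suc i) p) (M zero j) (M zero p) (M (suc i) j)) ⟩
      sum (λ i → z i * clear p M (suc i) j)
        ≡⟨ columns j ⟩
      0ℤ ∎

  row₀≡0⇒leftKernel : ∀ {n} (M : Matrix (suc n)) → (∀ j → M zero j ≡ 0ℤ) → LeftKernel M
  row₀≡0⇒leftKernel {n} M row≗0 = y , (zero , λ ()) , λ j →
    cong₂ _+_ (trans (*-identityˡ (M zero j)) (row≗0 j)) (sum-zero λ i → *-zeroˡ (M (suc i) j))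
    where
    y : Fin (suc n) → ℤ
    y zero    = 1ℤ
    y (suc i) = 0ℤ

  -- Induction on the order. A zero top row is a dependency by itself; otherwise any nonzero entry
  -- of that row is a pivot, and choosing the column freely avoids row exchanges. Order 0 cannot
  -- occur, the empty determinant being 1.
  singular⇒leftKernel : ∀ {n} (M : Matrix n) → Singular M → LeftKernel M
  singular⇒leftKernel {suc n} M det≡0 with any? (λ j → ¬? (M zero j ℤ.≟ 0ℤ))
  ... | no row≗0 = row₀≡0⇒leftKernel M λ j →
        decidable-stable (M zero j ℤ.≟ 0ℤ) (λ ≢0 → row≗0 (j , ≢0))
  ... | yes (p , a≢0) = clear-leftKernel p M a≢0
        (singular⇒leftKernel (minor zero p (clear p M)) (clear-singular p M a≢0 det≡0))

open Determinants

-- Counting cyclic triples by sums over ordered triples.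

module CycleCount where

  open import Data.Integer.Base using (_+_; _*_; _-_)
  open import Data.Integer.Properties using (*-identityˡ; *-identityʳ; pos-+)

  ind : {P : Set} → Dec P → ℤ
  ind P? = if does P? then 1ℤ else 0ℤ

  ind-× : {P Q : Set} (P? : Dec P) (Q? : Dec Q) → ind (P? ×-dec Q?) ≡ ind P? * ind Q?
  ind-× (yes _) (yes _) = refl
  ind-× (yes _) (no _)  = refl
  ind-× (no _)  (yes _) = refl
  ind-× (no _)  (no _)  = refl

  ind-⊎ : {P Q : Set} (P? : Dec P) (Q? : Dec Q) →
          ind (P? ⊎-dec Q?) ≡ ind P? + ind Q? - ind P? * ind Q?
  ind-⊎ (yes _) (yes _) = refl
  ind-⊎ (yes _) (no _)  = refl
  ind-⊎ (no _)  (yes _) = refl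
  ind-⊎ (no _)  (no _)  = refl

  filter-map-length : {X Y : Set} {P : Y → Set} (P? : Decidable P) (f : X → Y) (xs : List X) →
    length (filter P? (map f xs)) ≡ length (filter (λ x → P? (f x)) xs)
  filter-map-length P? f []       = refl
  filter-map-length P? f (x ∷ xs) with does (P? (f x))
  ... | true  = cong suc (filter-map-length P? f xs)
  ... | false = filter-map-length P? f xs

  count-tabulate : {X : Set} {P : X → Set} (P? : Decidable P) → ∀ {n} (f : Fin n → X) →
    + length (filter P? (tabulate f)) ≡ sum (λ i → ind (P? (f i)))
  count-tabulate P? {zero}  f = refl
  count-tabulate P? {suc n} f with does (P? (f zero))
  ... | true  = trans (pos-+ 1 _) (cong (λ x → 1ℤ + x) (count-tabulate P? (f ∘ suc)))
  ... | false = trans (pos-+ 0 _) (cong (λ x → 0ℤ + x) (count-tabulate P? (f ∘ suc)))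

  count-product : {X Y : Set} {P : X × Y → Set} (P? : Decidable P) →
    ∀ {n} (f : Fin n → X) (ys : List Y) →
    + length (filter P? (cartesianProduct (tabulate f) ys))
      ≡ sum (λ i → + length (filter (λ y → P? (f i , y)) ys))
  count-product P? {zero}  f ys = refl
  count-product P? {suc n} f ys = begin
    + length (filter P? (block ++ rest))
      ≡⟨ cong (+_ ∘ length) (filter-++ P? block rest) ⟩
    + length (filter P? block ++ filter P? rest)
      ≡⟨ cong +_ (length-++ (filter P? block)) ⟩
    + (length (filter P? block) ℕ.+ length (filter P? rest))
      ≡⟨ pos-+ (length (filter P? block)) (length (filter P? rest)) ⟩
    + length (filter P? block) + + length (filter P? rest)
      ≡⟨ cong₂ (λ x y → + x + y) (filter-map-length P? (f zero ,_) ys) (count-product P? (f ∘ suc) ys) ⟩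
    sum (λ i → + length (filter (λ y → P? (f i , y)) ys)) ∎
    where
    block = map (f zero ,_) ys
    rest  = cartesianProduct (tabulate (f ∘ suc)) ys

  sum₃ : ∀ {n} → (Fin n → Fin n → Fin n → ℤ) → ℤ
  sum₃ F = sum λ i → sum λ j → sum λ k → F i j k

  sum₃-cong : ∀ {n} {F G : Fin n → Fin n → Fin n → ℤ} →
              (∀ i j k → F i j k ≡ G i j k) → sum₃ F ≡ sum₃ G
  sum₃-cong F≗G = sum-cong-≗ λ i → sum-cong-≗ λ j → sum-cong-≗ λ k → F≗G i j k

  sum₃-+ : ∀ {n} (F G : Fin n → Fin n → Fin n → ℤ) →
           sum₃ (λ i j k → F i j k + G i j k) ≡ sum₃ F + sum₃ G
  sum₃-+ F G = begin
    sum₃ (λ i j k → F i j k + G i j k)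
      ≡⟨ (sum-cong-≗ λ i → trans (sum-cong-≗ λ j → ∑-distrib-+ (F i j) (G i j))
                                 (∑-distrib-+ (λ j → sum (F i j)) (λ j → sum (G i j)))) ⟩
    sum (λ i → sum (λ j → sum (F i j)) + sum (λ j → sum (G i j)))
      ≡⟨ ∑-distrib-+ (λ i → sum (λ j → sum (F i j))) (λ i → sum (λ j → sum (G i j))) ⟩
    sum₃ F + sum₃ G ∎

  sum₃-swap₁₂ : ∀ {n} (F : Fin n → Fin n → Fin n → ℤ) → sum₃ F ≡ sum₃ (λ i j k → F j i k)
  sum₃-swap₁₂ F = ∑-comm (λ i j → sum (F i j))

  sum₃-swap₂₃ : ∀ {n} (F : Fin n → Fin n → Fin n → ℤ) → sum₃ F ≡ sum₃ (λ i j k → F i k j)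
  sum₃-swap₂₃ F = sum-cong-≗ λ i → ∑-comm (F i)

  ordered : ∀ {n} → Fin n → Fin n → Fin n → ℤ
  ordered i j k = ind (i <? j) * ind (j <? k)

  ind-true : {P : Set} (P? : Dec P) → P → ind P? ≡ 1ℤ
  ind-true P? p = cong (λ b → if b then 1ℤ else 0ℤ) (dec-true P? p)

  ind-false : {P : Set} (P? : Dec P) → ¬ P → ind P? ≡ 0ℤ
  ind-false P? ¬p = cong (λ b → if b then 1ℤ else 0ℤ) (dec-false P? ¬p)

  -- Of the eight outcomes of the three comparisons two are cyclic and contradict transitivity; each
  -- of the other six makes a single summand equal to 1.
  one-order : ∀ {n} {i j k : Fin n} → i ≢ j → j ≢ k → k ≢ i →
    ordered i j k + ordered j k i + ordered k i j
    + ordered i k j + ordered k j i + ordered j i k ≡ 1ℤ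
  one-order {_} {i} {j} {k} i≢j j≢k k≢i with <-cmp i j | <-cmp j k | <-cmp k i
  ... | tri≈ _ i≡j _ | _ | _ = ⊥-elim (i≢j i≡j)
  ... | _ | tri≈ _ j≡k _ | _ = ⊥-elim (j≢k j≡k)
  ... | _ | _ | tri≈ _ k≡i _ = ⊥-elim (k≢i k≡i)
  ... | tri< i<j _ _ | tri< j<k _ _ | tri< k<i _ _ =
    ⊥-elim (<-asym {x = i} {k} (<-trans {i = i} {j} {k} i<j j<k) k<i)
  ... | tri> _ _ j<i | tri> _ _ k<j | tri> _ _ i<k =
    ⊥-elim (<-asym {x = i} {k} i<k (<-trans {i = k} {j} {i} k<j j<i))
  ... | tri< p _ ¬p | tri< q _ ¬q | tri> ¬r _ r
    rewrite ind-true (i <? j) p | ind-false (j <? i) ¬p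
          | ind-true (j <? k) q | ind-false (k <? j) ¬q
          | ind-false (k <? i) ¬r | ind-true (i <? k) r = refl
  ... | tri< p _ ¬p | tri> ¬q _ q | tri< r _ ¬r
    rewrite ind-true (i <? j) p | ind-false (j <? i) ¬p
          | ind-false (j <? k) ¬q | ind-true (k <? j) q
          | ind-true (k <? i) r | ind-false (i <? k) ¬r = refl
  ... | tri< p _ ¬p | tri> ¬q _ q | tri> ¬r _ r
    rewrite ind-true (i <? j) p | ind-false (j <? i) ¬p
          | ind-false (j <? k) ¬q | ind-true (k <? j) q
          | ind-false (k <? i) ¬r | ind-true (i <? k) r = refl
  ... | tri> ¬p _ p | tri< q _ ¬q | tri< r _ ¬r
    rewrite ind-false (i <? j) ¬p | ind-true (j <? i) p
          | ind-true (j <? k) q | ind-false (k <? j) ¬q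
          | ind-true (k <? i) r | ind-false (i <? k) ¬r = refl
  ... | tri> ¬p _ p | tri< q _ ¬q | tri> ¬r _ r
    rewrite ind-false (i <? j) ¬p | ind-true (j <? i) p
          | ind-true (j <? k) q | ind-false (k <? j) ¬q
          | ind-false (k <? i) ¬r | ind-true (i <? k) r = refl
  ... | tri> ¬p _ p | tri> ¬q _ q | tri< r _ ¬r
    rewrite ind-false (i <? j) ¬p | ind-true (j <? i) p
          | ind-false (j <? k) ¬q | ind-true (k <? j) q
          | ind-true (k <? i) r | ind-false (i <? k) ¬r = refl

  I-diagonal : ∀ {n} (i : Fin n) → I n i i ≡ 1ℤ
  I-diagonal i = ind-true (i ≟ i) refl

  I-offDiagonal : ∀ {n} {i j : Fin n} → i ≢ j → I n i j ≡ 0ℤ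
  I-offDiagonal {_} {i} {j} i≢j = ind-false (i ≟ j) i≢j

  sum-I : ∀ {n} (f : Fin n → ℤ) j → sum (λ k → I n j k * f k) ≡ f j
  sum-I {n} f j = begin
    sum (λ k → I n j k * f k)
      ≡⟨ sum-single j (λ k k≢j → cong (_* f k) (I-offDiagonal (k≢j ∘ sym))) ⟩
    I n j j * f j ≡⟨ cong (_* f j) (I-diagonal j) ⟩
    1ℤ * f j      ≡⟨ *-identityˡ (f j) ⟩
    f j           ∎

  sum-const : ∀ n x → sum {n} (λ _ → x) ≡ + n * x
  sum-const zero    x = refl
  sum-const (suc n) x = begin
    x + sum {n} (λ _ → x) ≡⟨ cong (λ y → x + y) (sum-const n x) ⟩
    x + + n * x           ≡⟨ lemma (+ n) x ⟩
    (1ℤ + + n) * x        ≡⟨ cong (_* x) (pos-+ 1 n) ⟨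
    + suc n * x           ∎
    where
    lemma : ∀ m x → x + m * x ≡ (1ℤ + m) * x
    lemma = solve-∀

  score : ∀ {n} → Matrix n → Fin n → ℤ
  score M i = sum (M i)

  scoreSquares : ∀ {n} → Matrix n → ℤ
  scoreSquares M = sum λ i → score M i * score M i

  module Tournament {n : ℕ} (M : Matrix n) (T : IsTournament M) where
    open IsTournament T

    diagonal : ∀ i → M i i ≡ 0ℤ
    diagonal i with zero-one i i | M+Mᵀ≡J-I i i
    ... | inj₁ Mᵢᵢ≡0 | _ = Mᵢᵢ≡0
    ... | inj₂ Mᵢᵢ≡1 | eq rewrite Mᵢᵢ≡1 | I-diagonal i with () ← eq

    arc-either : ∀ {i j} → i ≢ j → M i j + M j i ≡ 1ℤ
    arc-either {i} {j} i≢j = trans (M+Mᵀ≡J-I i j) (cong (λ x → 1ℤ - x) (I-offDiagonal i≢j))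

    arc-idem : ∀ i j → M i j * M i j ≡ M i j
    arc-idem i j with zero-one i j
    ... | inj₁ eq rewrite eq = refl
    ... | inj₂ eq rewrite eq = refl

    arc-antisym : ∀ i j → M i j * M j i ≡ 0ℤ
    arc-antisym i j with i ≟ j
    ... | yes refl rewrite diagonal i = refl
    ... | no i≢j with zero-one i j | arc-either i≢j
    ...   | inj₁ eq | _   rewrite eq = refl
    ...   | inj₂ eq | sum₁ rewrite eq = trans (lemma (M j i)) (cong (_- 1ℤ) sum₁)
      where
      lemma : ∀ x → 1ℤ * x ≡ 1ℤ + x - 1ℤ
      lemma = solve-∀

    ind-arc : ∀ i j → ind (arc? M i j) ≡ M i j
    ind-arc i j with zero-one i j
    ... | inj₁ eq rewrite eq = refl
    ... | inj₂ eq rewrite eq = refl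

    cyc : Fin n → Fin n → Fin n → ℤ
    cyc i j k = M i j * (M j k * M k i)

    ind-directedCycle : ∀ i j k → ind (directedCycle? M i j k) ≡ cyc i j k
    ind-directedCycle i j k = begin
      ind (directedCycle? M i j k)
        ≡⟨ ind-× (arc? M i j) (arc? M j k ×-dec arc? M k i) ⟩
      ind (arc? M i j) * ind (arc? M j k ×-dec arc? M k i)
        ≡⟨ cong₂ _*_ (ind-arc i j) (trans (ind-× (arc? M j k) (arc? M k i))
                                          (cong₂ _*_ (ind-arc j k) (ind-arc k i))) ⟩
      cyc i j k ∎

    -- The product contains two opposite arcs. This kills the inclusion-exclusion term of the
    -- disjunction in `CyclicTriple`.
    cyc-exclusive : ∀ i j k → cyc i j k * cyc i k j ≡ 0ℤ
    cyc-exclusive i j k = begin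
      cyc i j k * cyc i k j
        ≡⟨ lemma (M i j) (M j k) (M k i) (M i k) (M k j) (M j i) ⟩
      M i j * M j i * (M j k * M k i * M i k * M k j)
        ≡⟨ cong (_* (M j k * M k i * M i k * M k j)) (arc-antisym i j) ⟩
      0ℤ ∎
      where
      lemma : ∀ a b c c′ b′ a′ → a * (b * c) * (c′ * (b′ * a′)) ≡ a * a′ * (b * c * c′ * b′)
      lemma = solve-∀

    ind-cyclicTriple : ∀ i j k →
      ind (cyclicTriple? M (i , j , k)) ≡ ordered i j k * cyc i j k + ordered i j k * cyc i k j
    ind-cyclicTriple i j k = begin
      ind (cyclicTriple? M (i , j , k))
        ≡⟨ ind-× (i <? j ×-dec j <? k) (directedCycle? M i j k ⊎-dec directedCycle? M i k j) ⟩
      ind (i <? j ×-dec j <? k) * ind (directedCycle? M i j k ⊎-dec directedCycle? M i k j)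
        ≡⟨ cong₂ _*_ (ind-× (i <? j) (j <? k))
                     (ind-⊎ (directedCycle? M i j k) (directedCycle? M i k j)) ⟩
      ordered i j k * (ind (directedCycle? M i j k) + ind (directedCycle? M i k j)
                       - ind (directedCycle? M i j k) * ind (directedCycle? M i k j))
        ≡⟨ cong₂ (λ x y → ordered i j k * (x + y - x * y)) (ind-directedCycle i j k) (ind-directedCycle i k j) ⟩
      ordered i j k * (cyc i j k + cyc i k j - cyc i j k * cyc i k j)
        ≡⟨ cong (λ x → ordered i j k * (cyc i j k + cyc i k j - x)) (cyc-exclusive i j k) ⟩
      ordered i j k * (cyc i j k + cyc i k j - 0ℤ)
        ≡⟨ lemma (ordered i j k) (cyc i j k) (cyc i k j) ⟩
      ordered i j k * cyc i j k + ordered i j k * cyc i k j ∎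
      where
      lemma : ∀ o x y → o * (x + y - 0ℤ) ≡ o * x + o * y
      lemma = solve-∀

    F G : Fin n → Fin n → Fin n → ℤ
    F i j k = ordered i j k * cyc i j k
    G i j k = ordered i j k * cyc i k j

    C₃-sum : + C₃ M ≡ sum₃ F + sum₃ G
    C₃-sum = begin
      + C₃ M
        ≡⟨ count-product (cyclicTriple? M) (λ i → i) (cartesianProduct (allFin n) (allFin n)) ⟩
      sum (λ i → + length (filter (λ jk → cyclicTriple? M (i , jk)) (cartesianProduct (allFin n) (allFin n))))
        ≡⟨ (sum-cong-≗ λ i → trans (count-product (λ jk → cyclicTriple? M (i , jk)) (λ j → j) (allFin n))
             (sum-cong-≗ λ j → count-tabulate (λ k → cyclicTriple? M (i , j , k)) (λ k → k))) ⟩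
      sum₃ (λ i j k → ind (cyclicTriple? M (i , j , k)))
        ≡⟨ sum₃-cong ind-cyclicTriple ⟩
      sum₃ (λ i j k → F i j k + G i j k)
        ≡⟨ sum₃-+ F G ⟩
      sum₃ F + sum₃ G ∎

    cyc-degenerate : ∀ i j k → i ≡ j → cyc i j k ≡ 0ℤ
    cyc-degenerate i j k refl = cong (_* (M i k * M k i)) (diagonal i)

    cyc-rotate : ∀ i j k → cyc i j k ≡ cyc j k i
    cyc-rotate i j k = lemma (M i j) (M j k) (M k i)
      where
      lemma : ∀ a b c → a * (b * c) ≡ b * (c * a)
      lemma = solve-∀

    -- Three distinct vertices have one increasing order among six. `F` is taken at the rotations of
    -- (i, j, k) and `G` at the reversed orders; since `G` reverses its arguments back, all six
    -- terms carry the same factor `cyc i j k` up to rotation. If two vertices coincide, that factor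
    -- is 0.
    cyc-split : ∀ i j k → cyc i j k ≡ F i j k + F j k i + F k i j + G i k j + G k j i + G j i k
    cyc-split i j k = sym (begin
      F i j k + F j k i + F k i j + G i k j + G k j i + G j i k
        ≡⟨ cong₂ _+_ (cong₂ _+_ (cong (_+ G i k j) (cong₂ (λ x y → F i j k + ordered j k i * x + ordered k i j * y)
             (sym (cyc-rotate i j k)) (cyc-rotate k i j)))
             (cong (ordered k j i *_) (cyc-rotate k i j))) (cong (ordered j i k *_) (sym (cyc-rotate i j k))) ⟩
      ordered i j k * c + ordered j k i * c + ordered k i j * c
        + ordered i k j * c + ordered k j i * c + ordered j i k * c
        ≡⟨ lemma c (ordered i j k) (ordered j k i) (ordered k i j) (ordered i k j) (ordered k j i) (ordered j i k) ⟩
      c * S ≡⟨ scaled ⟩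
      c ∎)
      where
      c = cyc i j k
      S = ordered i j k + ordered j k i + ordered k i j + ordered i k j + ordered k j i + ordered j i k
      lemma : ∀ c o₁ o₂ o₃ o₄ o₅ o₆ →
        o₁ * c + o₂ * c + o₃ * c + o₄ * c + o₅ * c + o₆ * c ≡ c * (o₁ + o₂ + o₃ + o₄ + o₅ + o₆)
      lemma = solve-∀
      vanishing : c ≡ 0ℤ → c * S ≡ c
      vanishing c≡0 = trans (cong (_* S) c≡0) (sym c≡0)
      scaled : c * S ≡ c
      scaled with i ≟ j | j ≟ k | k ≟ i
      ... | yes i≡j | _ | _ = vanishing (cyc-degenerate i j k i≡j)
      ... | no _ | yes j≡k | _ = vanishing (trans (cyc-rotate i j k) (cyc-degenerate j k i j≡k))
      ... | no _ | no _ | yes k≡i = vanishing (trans (sym (cyc-rotate k i j)) (cyc-degenerate k i j k≡i))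
      ... | no i≢j | no j≢k | no k≢i = trans (cong (c *_) (one-order i≢j j≢k k≢i)) (*-identityʳ c)

    -- A directed 3-cycle occurs once for each starting vertex. Formally, renaming summation indices
    -- turns the six sums of `cyc-split` into three copies each of `F` and `G`.
    sum-cyc : sum₃ cyc ≡ + 3 * + C₃ M
    sum-cyc = begin
      sum₃ cyc
        ≡⟨ sum₃-cong cyc-split ⟩
      sum₃ (λ i j k → F i j k + F j k i + F k i j + G i k j + G k j i + G j i k)
        ≡⟨ trans (sum₃-+ (λ i j k → F i j k + F j k i + F k i j + G i k j + G k j i) (λ i j k → G j i k))
           (cong (_+ sum₃ (λ i j k → G j i k))
           (trans (sum₃-+ (λ i j k → F i j k + F j k i + F k i j + G i k j) (λ i j k → G k j i))
           (cong (_+ sum₃ (λ i j k → G k j i))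
           (trans (sum₃-+ (λ i j k → F i j k + F j k i + F k i j) (λ i j k → G i k j))
           (cong (_+ sum₃ (λ i j k → G i k j))
           (trans (sum₃-+ (λ i j k → F i j k + F j k i) (λ i j k → F k i j))
           (cong (_+ sum₃ (λ i j k → F k i j))
           (sum₃-+ F (λ i j k → F j k i))))))))) ⟩
      sum₃ F + sum₃ (λ i j k → F j k i) + sum₃ (λ i j k → F k i j)
        + sum₃ (λ i j k → G i k j) + sum₃ (λ i j k → G k j i) + sum₃ (λ i j k → G j i k)
        ≡⟨ cong₂ _+_ (cong₂ _+_ (cong₂ _+_ (cong₂ (λ x y → sum₃ F + x + y) rot₁ rot₂) (sym (sum₃-swap₂₃ G)))
             rev) (sym (sum₃-swap₁₂ G)) ⟩
      sum₃ F + sum₃ F + sum₃ F + sum₃ G + sum₃ G + sum₃ G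
        ≡⟨ lemma (sum₃ F) (sum₃ G) ⟩
      + 3 * (sum₃ F + sum₃ G)
        ≡⟨ cong (+ 3 *_) C₃-sum ⟨
      + 3 * + C₃ M ∎
      where
      lemma : ∀ f g → f + f + f + g + g + g ≡ + 3 * (f + g)
      lemma = solve-∀
      rot₁ : sum₃ (λ i j k → F j k i) ≡ sum₃ F
      rot₁ = sym (trans (sum₃-swap₂₃ F) (sum₃-swap₁₂ (λ i j k → F i k j)))
      rot₂ : sum₃ (λ i j k → F k i j) ≡ sum₃ F
      rot₂ = sym (trans (sum₃-swap₁₂ F) (sum₃-swap₂₃ (λ i j k → F j i k)))
      rev : sum₃ (λ i j k → G k j i) ≡ sum₃ G
      rev = sym (trans (sum₃-swap₁₂ G) (trans (sum₃-swap₂₃ (λ i j k → G j i k)) (sum₃-swap₁₂ (λ i j k → G k i j))))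

open CycleCount

-- Cycle count in terms of scores, and the upper bound for singular matrices.

module ScoreBound where

  open import Data.Integer.Base using (-[1+_]; -1ℤ; _+_; _*_; _-_; -_; _≤_; +≤+; Positive)
  open import Data.Integer.Properties using (*-zeroʳ; *-identityʳ; +-identityʳ; *-comm;
    +-mono-≤; ≤-refl; ≤-antisym; ≤-trans; ≤-reflexive; 0≤i-j⇒j≤i; i≤j⇒0≤j-i;
    *-cancelˡ-≤-pos; *-monoˡ-≤-nonNeg; i*j≡0⇒i≡0∨j≡0)

  *-self-nonneg : ∀ i → 0ℤ ≤ i * i
  *-self-nonneg (+ zero)  = +≤+ ℕ.z≤n
  *-self-nonneg (+ suc n) = +≤+ ℕ.z≤n
  *-self-nonneg -[1+ n ]  = +≤+ ℕ.z≤n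

  sum-squares-nonneg : ∀ {n} (f : Fin n → ℤ) → 0ℤ ≤ sum (λ i → f i * f i)
  sum-squares-nonneg {zero}  f = ≤-refl
  sum-squares-nonneg {suc n} f = +-mono-≤ (*-self-nonneg (f zero)) (sum-squares-nonneg (f ∘ suc))

  sum-squares≡0 : ∀ {n} (f : Fin n → ℤ) → sum (λ i → f i * f i) ≡ 0ℤ → ∀ i → f i ≡ 0ℤ
  sum-squares≡0 {suc n} f Σ≡0 = λ where
      zero    → reduce (i*j≡0⇒i≡0∨j≡0 (f zero) (≤-antisym head≤0 (*-self-nonneg (f zero))))
      (suc i) → sum-squares≡0 (f ∘ suc) (≤-antisym tail≤0 (sum-squares-nonneg (f ∘ suc))) i
    where
    head≤0 : f zero * f zero ≤ 0ℤ
    head≤0 = ≤-trans (≤-reflexive (sym (+-identityʳ (f zero * f zero))))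
      (≤-trans (+-mono-≤ (≤-refl {f zero * f zero}) (sum-squares-nonneg (f ∘ suc))) (≤-reflexive Σ≡0))
    tail≤0 : sum (λ i → f (suc i) * f (suc i)) ≤ 0ℤ
    tail≤0 = ≤-trans (≤-reflexive (lemma (sum (λ i → f (suc i) * f (suc i)))))
      (≤-trans (+-mono-≤ (*-self-nonneg (f zero)) (≤-refl {sum (λ i → f (suc i) * f (suc i))})) (≤-reflexive Σ≡0))
      where
      lemma : ∀ x → x ≡ 0ℤ + x
      lemma = solve-∀

  square-cancel-nonneg : ∀ e x → e ≢ 0ℤ → 0ℤ ≤ e * e * x → 0ℤ ≤ x
  square-cancel-nonneg e x e≢0 0≤e²x =
    *-cancelˡ-≤-pos 0ℤ x (e * e) {{positive e e≢0}}
      (≤-trans (≤-reflexive (*-zeroʳ (e * e))) 0≤e²x)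
    where
    positive : ∀ e → e ≢ 0ℤ → Positive (e * e)
    positive (+ zero)  e≢0 = ⊥-elim (e≢0 refl)
    positive (+ suc n) _   = _
    positive -[1+ n ]  _   = _

  module Scores {n : ℕ} (M : Matrix n) (T : IsTournament M) where
    open IsTournament T
    open Tournament M T

    N R Q : ℤ
    N = + n
    R = sum (score M)
    Q = scoreSquares M

    arc-trichotomy : ∀ i j → M i j + M j i + I n i j ≡ 1ℤ
    arc-trichotomy i j = trans (cong (_+ I n i j) (M+Mᵀ≡J-I i j)) (lemma (I n i j))
      where
      lemma : ∀ x → 1ℤ - x + x ≡ 1ℤ
      lemma = solve-∀

    column-sum : ∀ j → sum (λ i → M i j) ≡ N - 1ℤ - score M j
    column-sum j = begin
      col                              ≡⟨ lemma col (score M j) ⟩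
      score M j + col + 1ℤ - 1ℤ - score M j ≡⟨ cong (λ x → x - 1ℤ - score M j) total ⟩
      N - 1ℤ - score M j               ∎
      where
      col = sum (λ i → M i j)
      lemma : ∀ c r → c ≡ r + c + 1ℤ - 1ℤ - r
      lemma = solve-∀
      total : score M j + col + 1ℤ ≡ N
      total = begin
        score M j + col + 1ℤ
          ≡⟨ cong₂ _+_ (∑-distrib-+ (M j) (λ i → M i j)) (sum-I (λ _ → 1ℤ) j) ⟨
        sum (λ i → M j i + M i j) + sum (λ i → I n j i * 1ℤ)
          ≡⟨ ∑-distrib-+ (λ i → M j i + M i j) (λ i → I n j i * 1ℤ) ⟨
        sum (λ i → M j i + M i j + I n j i * 1ℤ)
          ≡⟨ (sum-cong-≗ λ i → trans (cong (λ x → M j i + M i j + x) (*-identityʳ (I n j i))) (arc-trichotomy j i)) ⟩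
        sum {n} (λ _ → 1ℤ)    ≡⟨ sum-const n 1ℤ ⟩
        N * 1ℤ                ≡⟨ *-identityʳ N ⟩
        N                     ∎

    score-total : R + R ≡ N * (N - 1ℤ)
    score-total = begin
      R + R
        ≡⟨ cong (λ x → R + x) (∑-comm M) ⟩
      R + sum (λ j → sum (λ i → M i j))
        ≡⟨ ∑-distrib-+ (score M) (λ j → sum (λ i → M i j)) ⟨
      sum (λ j → score M j + sum (λ i → M i j))
        ≡⟨ (sum-cong-≗ λ j → trans (cong (λ x → score M j + x) (column-sum j)) (lemma (score M j) N)) ⟩
      sum {n} (λ _ → N - 1ℤ)
        ≡⟨ sum-const n (N - 1ℤ) ⟩
      N * (N - 1ℤ) ∎
      where
      lemma : ∀ r m → r + (m - 1ℤ - r) ≡ m - 1ℤ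
      lemma = solve-∀

    transitive : Fin n → Fin n → Fin n → ℤ
    transitive i j k = M i j * (M j k * M i k)

    -- Walks i → j → k are counted twice: by the direction of the arc between k and i, and by the
    -- middle vertex as in-degree times out-degree. A walk with k = i would use two opposite arcs.
    sum-paths : sum₃ cyc + sum₃ transitive ≡ (N - 1ℤ) * R - Q
    sum-paths = begin
      sum₃ cyc + sum₃ transitive
        ≡⟨ sum₃-+ cyc transitive ⟨
      sum₃ (λ i j k → cyc i j k + transitive i j k)
        ≡⟨ sum₃-cong path ⟩
      sum₃ (λ i j k → M i j * M j k)
        ≡⟨ sum₃-swap₁₂ (λ i j k → M i j * M j k) ⟩
      sum₃ (λ j i k → M i j * M j k)
        ≡⟨ (sum-cong-≗ λ j → trans (sum-cong-≗ λ i → sym (*-distribˡ-sum (M i j) (M j)))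
                                   (sym (*-distribʳ-sum (score M j) (λ i → M i j)))) ⟩
      sum (λ j → sum (λ i → M i j) * score M j)
        ≡⟨ (sum-cong-≗ λ j → trans (cong (_* score M j) (column-sum j)) (lemma₁ N (score M j))) ⟩
      sum (λ j → (N - 1ℤ) * score M j + -1ℤ * (score M j * score M j))
        ≡⟨ sum-linear (N - 1ℤ) -1ℤ (score M) (λ j → score M j * score M j) ⟩
      (N - 1ℤ) * R + -1ℤ * Q
        ≡⟨ lemma₂ ((N - 1ℤ) * R) Q ⟩
      (N - 1ℤ) * R - Q ∎
      where
      lemma₁ : ∀ m r → (m - 1ℤ - r) * r ≡ (m - 1ℤ) * r + -1ℤ * (r * r)
      lemma₁ = solve-∀
      lemma₂ : ∀ x q → x + -1ℤ * q ≡ x - q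
      lemma₂ = solve-∀
      factor : ∀ x y z w → x * (y * z) + x * (y * w) ≡ x * y * (z + w)
      factor = solve-∀
      path : ∀ i j k → cyc i j k + transitive i j k ≡ M i j * M j k
      path i j k = trans (factor (M i j) (M j k) (M k i) (M i k)) unit
        where
        unit : M i j * M j k * (M k i + M i k) ≡ M i j * M j k
        unit with k ≟ i
        ... | no k≢i   = trans (cong (M i j * M j k *_) (arc-either k≢i)) (*-identityʳ (M i j * M j k))
        ... | yes refl = trans (cong (_* (M k k + M k k)) (arc-antisym k j)) (sym (arc-antisym k j))

    -- The squared score of i counts ordered pairs of out-neighbours. A pair of distinct ones is
    -- joined by an arc one way or the other, hence the two copies; equal ones give the term `R`.
    sum-forks : sum₃ transitive + sum₃ transitive + R ≡ Q
    sum-forks = begin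
      sum₃ transitive + sum₃ transitive + R
        ≡⟨ cong₂ (λ x y → sum₃ transitive + x + y) (sum₃-swap₂₃ transitive)
             (sum-cong-≗ λ i → sum-cong-≗ λ j → sym (sum-I (M i) j)) ⟩
      sum₃ transitive + sum₃ (λ i j k → transitive i k j) + sum₃ (λ i j k → I n j k * M i k)
        ≡⟨ cong (_+ sum₃ (λ i j k → I n j k * M i k)) (sum₃-+ transitive (λ i j k → transitive i k j)) ⟨
      sum₃ (λ i j k → transitive i j k + transitive i k j) + sum₃ (λ i j k → I n j k * M i k)
        ≡⟨ sum₃-+ (λ i j k → transitive i j k + transitive i k j) (λ i j k → I n j k * M i k) ⟨
      sum₃ (λ i j k → transitive i j k + transitive i k j + I n j k * M i k)
        ≡⟨ sum₃-cong fork ⟩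
      sum₃ (λ i j k → M i j * M i k)
        ≡⟨ (sum-cong-≗ λ i → trans (sum-cong-≗ λ j → sym (*-distribˡ-sum (M i j) (M i)))
                                   (sym (*-distribʳ-sum (score M i) (M i)))) ⟩
      Q ∎
      where
      factor : ∀ x y z w d → x * (z * y) + y * (w * x) + d * y ≡ x * y * (z + w) + d * y
      factor = solve-∀
      fork : ∀ i j k → transitive i j k + transitive i k j + I n j k * M i k ≡ M i j * M i k
      fork i j k = trans (factor (M i j) (M i k) (M j k) (M k j) (I n j k)) unit
        where
        lemma₁ : ∀ p y → p * 1ℤ + 0ℤ * y ≡ p
        lemma₁ = solve-∀
        lemma₂ : ∀ p y → p * 0ℤ + 1ℤ * y ≡ y
        lemma₂ = solve-∀
        unit : M i j * M i k * (M j k + M k j) + I n j k * M i k ≡ M i j * M i k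
        unit with j ≟ k
        ... | no j≢k   = trans (cong (λ x → M i j * M i k * x + 0ℤ * M i k) (arc-either j≢k))
                               (lemma₁ (M i j * M i k) (M i k))
        ... | yes refl = trans (cong (λ x → M i j * M i j * (x + x) + 1ℤ * M i j) (diagonal j))
                               (trans (lemma₂ (M i j * M i j) (M i j)) (sym (arc-idem i j)))

    C₃-scores : + 12 * + C₃ M ≡ N * (N - 1ℤ) * (+ 2 * N - 1ℤ) - + 6 * Q
    C₃-scores = begin
      + 12 * + C₃ M
        ≡⟨ lemma₀ (+ C₃ M) ⟩
      + 4 * (+ 3 * + C₃ M)
        ≡⟨ cong (+ 4 *_) sum-cyc ⟨
      + 4 * sum₃ cyc
        -- The weights 4 and -2 are chosen to cancel the transitive triples.
        ≡⟨ lemma₁ (sum₃ cyc) (sum₃ transitive) R ⟩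
      + 4 * (sum₃ cyc + sum₃ transitive) - + 2 * (sum₃ transitive + sum₃ transitive + R) + + 2 * R
        ≡⟨ cong₂ (λ x y → + 4 * x - + 2 * y + + 2 * R) sum-paths sum-forks ⟩
      + 4 * ((N - 1ℤ) * R - Q) - + 2 * Q + + 2 * R
        ≡⟨ lemma₂ N R Q ⟩
      (R + R) * (+ 2 * N - 1ℤ) - + 6 * Q
        ≡⟨ cong (λ x → x * (+ 2 * N - 1ℤ) - + 6 * Q) score-total ⟩
      N * (N - 1ℤ) * (+ 2 * N - 1ℤ) - + 6 * Q ∎
      where
      lemma₀ : ∀ c → + 12 * c ≡ + 4 * (+ 3 * c)
      lemma₀ = solve-∀
      lemma₁ : ∀ c t r → + 4 * c ≡ + 4 * (c + t) - + 2 * (t + t + r) + + 2 * r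
      lemma₁ = solve-∀
      lemma₂ : ∀ m r q → + 4 * ((m - 1ℤ) * r - q) - + 2 * q + + 2 * r
                       ≡ (r + r) * (+ 2 * m - 1ℤ) - + 6 * q
      lemma₂ = solve-∀

    module _ (y : Fin n → ℤ) (ker : ∀ j → sum (λ i → y i * M i j) ≡ 0ℤ) where

      e : ℤ
      e = sum y

      kernel⊥scores : sum (λ i → y i * score M i) ≡ 0ℤ
      kernel⊥scores = begin
        sum (λ i → y i * score M i)        ≡⟨ (sum-cong-≗ λ i → *-distribˡ-sum (y i) (M i)) ⟩
        sum (λ i → sum (λ j → y i * M i j)) ≡⟨ ∑-comm (λ i j → y i * M i j) ⟩
        sum (λ j → sum (λ i → y i * M i j)) ≡⟨ sum-zero ker ⟩
        0ℤ                                 ∎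

      form : sum (λ i → sum (λ j → y i * y j * M i j)) ≡ 0ℤ
      form = begin
        sum (λ i → sum (λ j → y i * y j * M i j)) ≡⟨ ∑-comm (λ i j → y i * y j * M i j) ⟩
        sum (λ j → sum (λ i → y i * y j * M i j))
          ≡⟨ (sum-zero λ j → trans (sum-cong-≗ λ i → lemma (y i) (y j) (M i j))
               (trans (sym (*-distribˡ-sum (y j) (λ i → y i * M i j)))
                 (trans (cong (y j *_) (ker j)) (*-zeroʳ (y j))))) ⟩
        0ℤ ∎
        where
        lemma : ∀ a b m → a * b * m ≡ b * (a * m)
        lemma = solve-∀

      form′ : sum (λ i → sum (λ j → y i * y j * M j i)) ≡ 0ℤ
      form′ = begin
        sum (λ i → sum (λ j → y i * y j * M j i))
          ≡⟨ (sum-cong-≗ λ i → sum-cong-≗ λ j → cong (_* M j i) (*-comm (y i) (y j))) ⟩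
        sum (λ i → sum (λ j → y j * y i * M j i)) ≡⟨ ∑-comm (λ i j → y j * y i * M j i) ⟩
        sum (λ i → sum (λ j → y i * y j * M i j)) ≡⟨ form ⟩
        0ℤ ∎

      -- Evaluate yᵀ(M + Mᵀ)y = yᵀ(J - I)y, whose left side vanishes.
      kernel-norm : sum (λ i → y i * y i) ≡ e * e
      kernel-norm = sym (begin
        e * e
          ≡⟨ *-distribʳ-sum e y ⟩
        sum (λ i → y i * e)
          ≡⟨ (sum-cong-≗ λ i → *-distribˡ-sum (y i) y) ⟩
        sum (λ i → sum (λ j → y i * y j))
          ≡⟨ (sum-cong-≗ row) ⟩
        sum (λ i → a i + b i + y i * y i)
          ≡⟨ ∑-distrib-+ (λ i → a i + b i) (λ i → y i * y i) ⟩
        sum (λ i → a i + b i) + sum (λ i → y i * y i)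
          ≡⟨ cong (_+ sum (λ i → y i * y i)) (trans (∑-distrib-+ a b) (cong₂ _+_ form form′)) ⟩
        0ℤ + 0ℤ + sum (λ i → y i * y i)
          ≡⟨ lemma₂ (sum (λ i → y i * y i)) ⟩
        sum (λ i → y i * y i) ∎)
        where
        a b : Fin n → ℤ
        a i = sum (λ j → y i * y j * M i j)
        b i = sum (λ j → y i * y j * M j i)
        lemma₁ : ∀ u v m m′ d → u * v * (m + m′ + d) ≡ u * v * m + u * v * m′ + d * (u * v)
        lemma₁ = solve-∀
        lemma₂ : ∀ x → 0ℤ + 0ℤ + x ≡ x
        lemma₂ = solve-∀
        row : ∀ i → sum (λ j → y i * y j) ≡ a i + b i + y i * y i
        row i = begin
          sum (λ j → y i * y j)
            ≡⟨ (sum-cong-≗ λ j → trans (sym (*-identityʳ (y i * y j)))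
                 (trans (cong (y i * y j *_) (sym (arc-trichotomy i j)))
                   (lemma₁ (y i) (y j) (M i j) (M j i) (I n i j)))) ⟩
          sum (λ j → y i * y j * M i j + y i * y j * M j i + I n i j * (y i * y j))
            ≡⟨ ∑-distrib-+ (λ j → y i * y j * M i j + y i * y j * M j i) (λ j → I n i j * (y i * y j)) ⟩
          sum (λ j → y i * y j * M i j + y i * y j * M j i) + sum (λ j → I n i j * (y i * y j))
            ≡⟨ cong₂ _+_ (∑-distrib-+ (λ j → y i * y j * M i j) (λ j → y i * y j * M j i))
                         (sum-I (λ j → y i * y j) i) ⟩
          a i + b i + y i * y i ∎

      -- Twice the centred scores, scaled by e, plus the centred y, scaled by N: the
      -- vector whose vanishing is equality in Cauchy–Schwarz.
      w : Fin n → ℤ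
      w i = + 2 * e * score M i + (N * y i - e * N)

      sum-w² : sum (λ i → w i * w i) ≡ e * e * (+ 4 * Q - N * N * (N - 1ℤ))
      sum-w² = begin
        sum (λ i → w i * w i)
          -- The square has six moments: Σs², Σys, Σy², Σs, Σy and n. They are bracketed in pairs,
          -- with padding factors `1ℤ`, to fit the two-term `sum-linear`.
          ≡⟨ (sum-cong-≗ λ i → expand e (score M i) N (y i)) ⟩
        sum (λ i → 1ℤ * (c₁ * (score M i * score M i) + c₂ * (y i * score M i))
                 + 1ℤ * (1ℤ * (c₃ * (y i * y i) + c₄ * score M i) + 1ℤ * (c₅ * y i + c₆ * 1ℤ)))
          ≡⟨ sum-linear 1ℤ 1ℤ (λ i → c₁ * (score M i * score M i) + c₂ * (y i * score M i)) (λ i → 1ℤ * (c₃ * (y i * y i) + c₄ * score M i) + 1ℤ * (c₅ * y i + c₆ * 1ℤ)) ⟩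
        1ℤ * sum (λ i → c₁ * (score M i * score M i) + c₂ * (y i * score M i))
          + 1ℤ * sum (λ i → 1ℤ * (c₃ * (y i * y i) + c₄ * score M i) + 1ℤ * (c₅ * y i + c₆ * 1ℤ))
          ≡⟨ cong₂ (λ p q → 1ℤ * p + 1ℤ * q)
               (trans (sum-linear c₁ c₂ (λ i → score M i * score M i) (λ i → y i * score M i))
                 (cong (λ x → c₁ * Q + c₂ * x) kernel⊥scores))
               (trans (sum-linear 1ℤ 1ℤ (λ i → c₃ * (y i * y i) + c₄ * score M i) (λ i → c₅ * y i + c₆ * 1ℤ))
                 (cong₂ (λ p q → 1ℤ * p + 1ℤ * q)
                   (trans (sum-linear c₃ c₄ (λ i → y i * y i) (score M))
                     (cong (λ x → c₃ * x + c₄ * R) kernel-norm))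
                   (trans (sum-linear c₅ c₆ y (λ _ → 1ℤ))
                     (cong (λ x → c₅ * e + c₆ * x) (trans (sum-const n 1ℤ) (*-identityʳ N)))))) ⟩
        1ℤ * (c₁ * Q + c₂ * 0ℤ) + 1ℤ * (1ℤ * (c₃ * (e * e) + c₄ * R) + 1ℤ * (c₅ * e + c₆ * N))
          ≡⟨ collect e N Q R ⟩
        e * e * (+ 4 * Q + N * N * (N - 1ℤ) - + 2 * N * (R + R))
          ≡⟨ cong (λ x → e * e * (+ 4 * Q + N * N * (N - 1ℤ) - + 2 * N * x)) score-total ⟩
        e * e * (+ 4 * Q + N * N * (N - 1ℤ) - + 2 * N * (N * (N - 1ℤ)))
          ≡⟨ final e N Q ⟩
        e * e * (+ 4 * Q - N * N * (N - 1ℤ)) ∎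
        where
        c₁ c₂ c₃ c₄ c₅ c₆ : ℤ
        c₁ = + 4 * e * e
        c₂ = + 4 * e * N
        c₃ = N * N
        c₄ = - (+ 4 * e * e * N)
        c₅ = - (+ 2 * e * N * N)
        c₆ = e * e * N * N
        expand : ∀ e r N y → (+ 2 * e * r + (N * y - e * N)) * (+ 2 * e * r + (N * y - e * N)) ≡
          1ℤ * (+ 4 * e * e * (r * r) + + 4 * e * N * (y * r))
            + 1ℤ * (1ℤ * (N * N * (y * y) + - (+ 4 * e * e * N) * r)
                    + 1ℤ * (- (+ 2 * e * N * N) * y + e * e * N * N * 1ℤ))
        expand = solve-∀
        collect : ∀ e N Q R →
          1ℤ * (+ 4 * e * e * Q + + 4 * e * N * 0ℤ)
            + 1ℤ * (1ℤ * (N * N * (e * e) + - (+ 4 * e * e * N) * R)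
                    + 1ℤ * (- (+ 2 * e * N * N) * e + e * e * N * N * N))
          ≡ e * e * (+ 4 * Q + N * N * (N - 1ℤ) - + 2 * N * (R + R))
        collect = solve-∀
        final : ∀ e N Q → e * e * (+ 4 * Q + N * N * (N - 1ℤ) - + 2 * N * (N * (N - 1ℤ)))
                        ≡ e * e * (+ 4 * Q - N * N * (N - 1ℤ))
        final = solve-∀

    singular⇒scores : Singular M → N * N * (N - 1ℤ) ≤ + 4 * Q
    singular⇒scores det≡0 with singular⇒leftKernel M det≡0
    ... | y , (i , yᵢ≢0) , ker = 0≤i-j⇒j≤i (square-cancel-nonneg (e y ker) _ e≢0
          (≤-trans (sum-squares-nonneg (w y ker)) (≤-reflexive (sum-w² y ker))))
      where
      e≢0 : e y ker ≢ 0ℤ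
      e≢0 e≡0 = yᵢ≢0 (sum-squares≡0 y (trans (kernel-norm y ker) (cong₂ _*_ e≡0 e≡0)) i)

    -- The slack here is exactly three times the slack of `singular⇒scores`, so nothing is lost in
    -- passing from scores to cycles.
    singular⇒C₃-bound : Singular M → + 24 * + C₃ M ≤ N * (N - 1ℤ) * (N - + 2)
    singular⇒C₃-bound det≡0 = 0≤i-j⇒j≤i (≤-trans
      (*-monoˡ-≤-nonNeg (+ 3) (i≤j⇒0≤j-i (singular⇒scores det≡0)))
      (≤-reflexive (begin
        + 3 * (+ 4 * Q - N * N * (N - 1ℤ))
          ≡⟨ lemma₁ N Q ⟩
        N * (N - 1ℤ) * (N - + 2) - + 2 * (N * (N - 1ℤ) * (+ 2 * N - 1ℤ) - + 6 * Q)
          ≡⟨ cong (λ x → N * (N - 1ℤ) * (N - + 2) - + 2 * x) C₃-scores ⟨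
        N * (N - 1ℤ) * (N - + 2) - + 2 * (+ 12 * + C₃ M)
          ≡⟨ lemma₂ (N * (N - 1ℤ) * (N - + 2)) (+ C₃ M) ⟩
        N * (N - 1ℤ) * (N - + 2) - + 24 * + C₃ M ∎)))
      where
      lemma₁ : ∀ N Q → + 3 * (+ 4 * Q - N * N * (N - 1ℤ))
        ≡ N * (N - 1ℤ) * (N - + 2) - + 2 * (N * (N - 1ℤ) * (+ 2 * N - 1ℤ) - + 6 * Q)
      lemma₁ = solve-∀
      lemma₂ : ∀ p c → p - + 2 * (+ 12 * c) ≡ p - + 24 * c
      lemma₂ = solve-∀

open ScoreBound

-- A sink added to a nearly regular tournament.

module Extremal where

  open import Data.Integer.Base using (_+_; _*_; _-_; -_)
  open import Data.Integer.Properties using (*-identityʳ; pos-+)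

  -- Integer-valued, so that both parities are handled by one polynomial identity modulo p² = p.
  parity : ℕ → ℤ
  parity zero    = 0ℤ
  parity (suc n) = 1ℤ - parity n

  parity-zero-one : ∀ n → parity n ≡ 0ℤ ⊎ parity n ≡ 1ℤ
  parity-zero-one zero    = inj₁ refl
  parity-zero-one (suc n) with parity-zero-one n
  ... | inj₁ eq rewrite eq = inj₂ refl
  ... | inj₂ eq rewrite eq = inj₁ refl

  parity-idem : ∀ n → parity n * parity n ≡ parity n
  parity-idem n with parity-zero-one n
  ... | inj₁ eq rewrite eq = refl
  ... | inj₂ eq rewrite eq = refl

  parity-2* : ∀ k → parity (k ℕ.* 2) ≡ 0ℤ
  parity-2* zero    = refl
  parity-2* (suc k) = cong (λ x → 1ℤ - (1ℤ - x)) (parity-2* k)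

  pos-suc : ∀ n → + suc n ≡ 1ℤ + + n
  pos-suc n = pos-+ 1 n

  mutual
    -- The sum is the floor of n/2, and its shifted companion is the ceiling. Splitting off the
    -- first term shifts the index, so each identity reduces to the other.
    sum-parity : ∀ n → + 2 * sum {n} (parity ∘ toℕ) ≡ + n - parity n
    sum-parity zero    = refl
    sum-parity (suc n) = begin
      + 2 * (0ℤ + sum {n} (λ i → parity (suc (toℕ i)))) ≡⟨ lemma₁ (sum {n} (λ i → parity (suc (toℕ i)))) ⟩
      + 2 * sum {n} (λ i → parity (suc (toℕ i)))        ≡⟨ sum-parity-suc n ⟩
      + n + parity n                            ≡⟨ lemma₂ (+ n) (parity n) ⟩
      1ℤ + + n - (1ℤ - parity n)                ≡⟨ cong (_- (1ℤ - parity n)) (pos-suc n) ⟨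
      + suc n - parity (suc n)                  ∎
      where
      lemma₁ : ∀ x → + 2 * (0ℤ + x) ≡ + 2 * x
      lemma₁ = solve-∀
      lemma₂ : ∀ x p → x + p ≡ 1ℤ + x - (1ℤ - p)
      lemma₂ = solve-∀

    sum-parity-suc : ∀ n → + 2 * sum {n} (λ i → parity (suc (toℕ i))) ≡ + n + parity n
    sum-parity-suc zero    = refl
    sum-parity-suc (suc n) = begin
      + 2 * (1ℤ + sum {n} (λ i → parity (suc (suc (toℕ i)))))
        ≡⟨ cong (λ x → + 2 * (1ℤ + x)) (sum-cong-≗ {n} λ i → lemma₁ (parity (toℕ i))) ⟩
      + 2 * (1ℤ + sum {n} (parity ∘ toℕ))
        ≡⟨ lemma₂ (sum {n} (parity ∘ toℕ)) ⟩
      + 2 + + 2 * sum {n} (parity ∘ toℕ)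
        ≡⟨ cong (λ x → + 2 + x) (sum-parity n) ⟩
      + 2 + (+ n - parity n)
        ≡⟨ lemma₃ (+ n) (parity n) ⟩
      1ℤ + + n + (1ℤ - parity n)
        ≡⟨ cong (_+ (1ℤ - parity n)) (pos-suc n) ⟨
      + suc n + parity (suc n) ∎
      where
      lemma₁ : ∀ p → 1ℤ - (1ℤ - p) ≡ p
      lemma₁ = solve-∀
      lemma₂ : ∀ x → + 2 * (1ℤ + x) ≡ + 2 + + 2 * x
      lemma₂ = solve-∀
      lemma₃ : ∀ x p → + 2 + (x - p) ≡ 1ℤ + x + (1ℤ - p)
      lemma₃ = solve-∀

  -- For i < j, the arc goes from i to j if j − i is odd and back if it is even.
  balanced : ∀ n → Matrix n
  balanced (suc n) zero    zero    = 0ℤ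
  balanced (suc n) zero    (suc j) = parity (suc (toℕ j))
  balanced (suc n) (suc i) zero    = parity (toℕ i)
  balanced (suc n) (suc i) (suc j) = balanced n i j

  balanced-isTournament : ∀ n → IsTournament (balanced n)
  balanced-isTournament n = record { zero-one = zo n ; M+Mᵀ≡J-I = total n }
    where
    zo : ∀ n i j → balanced n i j ≡ 0ℤ ⊎ balanced n i j ≡ 1ℤ
    zo (suc n) zero    zero    = inj₁ refl
    zo (suc n) zero    (suc j) = parity-zero-one (suc (toℕ j))
    zo (suc n) (suc i) zero    = parity-zero-one (toℕ i)
    zo (suc n) (suc i) (suc j) = zo n i j
    lemma₁ : ∀ p → 1ℤ - p + p ≡ 1ℤ - 0ℤ
    lemma₁ = solve-∀
    lemma₂ : ∀ p → p + (1ℤ - p) ≡ 1ℤ - 0ℤ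
    lemma₂ = solve-∀
    total : ∀ n i j → balanced n i j + balanced n j i ≡ 1ℤ - I n i j
    total (suc n) zero    zero    = refl
    total (suc n) zero    (suc j) = lemma₁ (parity (toℕ j))
    total (suc n) (suc i) zero    = lemma₂ (parity (toℕ i))
    total (suc n) (suc i) (suc j) = total n i j

  -- For odd n the correction vanishes and the tournament is regular (a circulant one). For even n
  -- the scores alternate between n/2 and n/2 - 1.
  balanced-score : ∀ n i → + 2 * score (balanced n) i
    ≡ + n - 1ℤ + (1ℤ - parity n) * (1ℤ - + 2 * parity (toℕ i))
  balanced-score (suc n) zero = begin
    + 2 * (0ℤ + sum {n} (λ i → parity (suc (toℕ i)))) ≡⟨ lemma₁ (sum {n} (λ i → parity (suc (toℕ i)))) ⟩
    + 2 * sum {n} (λ i → parity (suc (toℕ i)))        ≡⟨ sum-parity-suc n ⟩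
    + n + parity n                            ≡⟨ lemma₂ (+ n) (parity n) ⟩
    1ℤ + + n - 1ℤ + (1ℤ - (1ℤ - parity n)) * 1ℤ
      ≡⟨ cong (λ x → x - 1ℤ + (1ℤ - (1ℤ - parity n)) * 1ℤ) (pos-suc n) ⟨
    + suc n - 1ℤ + (1ℤ - (1ℤ - parity n)) * 1ℤ ∎
    where
    lemma₁ : ∀ x → + 2 * (0ℤ + x) ≡ + 2 * x
    lemma₁ = solve-∀
    lemma₂ : ∀ x p → x + p ≡ 1ℤ + x - 1ℤ + (1ℤ - (1ℤ - p)) * 1ℤ
    lemma₂ = solve-∀
  balanced-score (suc n) (suc i) = begin
    + 2 * (q + score (balanced n) i)
      ≡⟨ lemma₁ q (score (balanced n) i) ⟩
    + 2 * q + + 2 * score (balanced n) i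
      ≡⟨ cong (λ x → + 2 * q + x) (balanced-score n i) ⟩
    + 2 * q + (+ n - 1ℤ + (1ℤ - p) * (1ℤ - + 2 * q))
      ≡⟨ lemma₂ (+ n) p q ⟩
    1ℤ + + n - 1ℤ + (1ℤ - (1ℤ - p)) * (1ℤ - + 2 * (1ℤ - q))
      ≡⟨ cong (λ x → x - 1ℤ + (1ℤ - (1ℤ - p)) * (1ℤ - + 2 * (1ℤ - q))) (pos-suc n) ⟨
    + suc n - 1ℤ + (1ℤ - (1ℤ - p)) * (1ℤ - + 2 * (1ℤ - q)) ∎
    where
    p = parity n
    q = parity (toℕ i)
    lemma₁ : ∀ q s → + 2 * (q + s) ≡ + 2 * q + + 2 * s
    lemma₁ = solve-∀
    lemma₂ : ∀ x p q → + 2 * q + (x - 1ℤ + (1ℤ - p) * (1ℤ - + 2 * q))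
      ≡ 1ℤ + x - 1ℤ + (1ℤ - (1ℤ - p)) * (1ℤ - + 2 * (1ℤ - q))
    lemma₂ = solve-∀

  -- The sink gets index 0, the row along which `det` expands, so singularity is visible term by
  -- term.
  withSink : ∀ {n} → Matrix n → Matrix (suc n)
  withSink M zero    j       = 0ℤ
  withSink M (suc i) zero    = 1ℤ
  withSink M (suc i) (suc j) = M i j

  withSink-isTournament : ∀ {n} {M : Matrix n} → IsTournament M → IsTournament (withSink M)
  withSink-isTournament {n} {M} T = record { zero-one = zo ; M+Mᵀ≡J-I = total }
    where
    open IsTournament T
    zo : ∀ i j → withSink M i j ≡ 0ℤ ⊎ withSink M i j ≡ 1ℤ
    zo zero    j       = inj₁ refl
    zo (suc i) zero    = inj₂ refl
    zo (suc i) (suc j) = zero-one i j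
    total : ∀ i j → withSink M i j + withSink M j i ≡ 1ℤ - I (suc n) i j
    total zero    zero    = refl
    total zero    (suc j) = refl
    total (suc i) zero    = refl
    total (suc i) (suc j) = M+Mᵀ≡J-I i j

  withSink-singular : ∀ {n} (M : Matrix n) → Singular (withSink M)
  withSink-singular M = sum-zero λ j → lemma (sgn j) (det (minor zero j (withSink M)))
    where
    lemma : ∀ s d → s * 0ℤ * d ≡ 0ℤ
    lemma = solve-∀

  extremal : ∀ m → Matrix (suc m)
  extremal m = withSink (balanced m)

  extremal-isTournament : ∀ m → IsTournament (extremal m)
  extremal-isTournament m = withSink-isTournament (balanced-isTournament m)

  extremal∈𝒮 : ∀ m → 𝒮 (suc m) (extremal m)
  extremal∈𝒮 m = extremal-isTournament m , withSink-singular (balanced m)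

  extremal-scoreSquares : ∀ m → + 4 * scoreSquares (extremal m)
    ≡ + m * (+ m + 1ℤ) * (+ m + 1ℤ) + (1ℤ - parity m) * + m
  extremal-scoreSquares m = begin
    + 4 * (score (extremal m) zero * score (extremal m) zero + sum {m} (λ i → (1ℤ + s i) * (1ℤ + s i)))
      ≡⟨ cong (λ x → + 4 * (x * x + sum {m} (λ i → (1ℤ + s i) * (1ℤ + s i)))) (sum-zero {suc m} (λ _ → refl)) ⟩
    + 4 * (0ℤ + sum {m} (λ i → (1ℤ + s i) * (1ℤ + s i)))
      ≡⟨ lemma₀ (sum {m} (λ i → (1ℤ + s i) * (1ℤ + s i))) ⟩
    + 4 * sum {m} (λ i → (1ℤ + s i) * (1ℤ + s i))
      ≡⟨ *-distribˡ-sum {m} (+ 4) (λ i → (1ℤ + s i) * (1ℤ + s i)) ⟩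
    sum {m} (λ i → + 4 * ((1ℤ + s i) * (1ℤ + s i)))
      ≡⟨ sum-cong-≗ {m} term ⟩
    sum {m} (λ i → a * 1ℤ + b * q i)
      ≡⟨ sum-linear {m} a b (λ _ → 1ℤ) q ⟩
    a * sum {m} (λ _ → 1ℤ) + b * sum {m} q
      ≡⟨ cong (λ x → a * x + b * sum {m} q) (trans (sum-const m 1ℤ) (*-identityʳ (+ m))) ⟩
    a * + m + b * sum {m} q
      ≡⟨ lemma₁ (+ m) p (sum {m} q) ⟩
    a * + m - + 2 * (+ m + 1ℤ) * (1ℤ - p) * (+ 2 * sum {m} q)
      ≡⟨ cong (λ x → a * + m - + 2 * (+ m + 1ℤ) * (1ℤ - p) * x) (sum-parity m) ⟩
    a * + m - + 2 * (+ m + 1ℤ) * (1ℤ - p) * (+ m - p)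
      -- The cofactor -m - 2 is the quotient left when the target is subtracted and the difference
      -- is divided by p² - p, which is 0 for a parity.
      ≡⟨ lemma₂ (+ m) p ⟩
    + m * (+ m + 1ℤ) * (+ m + 1ℤ) + (1ℤ - p) * + m + (p * p - p) * (- + m - + 2)
      ≡⟨ cong (λ x → + m * (+ m + 1ℤ) * (+ m + 1ℤ) + (1ℤ - p) * + m + (x - p) * (- + m - + 2)) (parity-idem m) ⟩
    + m * (+ m + 1ℤ) * (+ m + 1ℤ) + (1ℤ - p) * + m + (p - p) * (- + m - + 2)
      ≡⟨ lemma₃ (+ m) p ⟩
    + m * (+ m + 1ℤ) * (+ m + 1ℤ) + (1ℤ - p) * + m ∎
    where
    s q : Fin m → ℤ
    s i = score (balanced m) i
    q i = parity (toℕ i)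
    p a b : ℤ
    p = parity m
    a = (+ m + 1ℤ) * (+ m + 1ℤ) + + 2 * (+ m + 1ℤ) * (1ℤ - p) + (1ℤ - p) * (1ℤ - p)
    b = - (+ 4 * (+ m + 1ℤ) * (1ℤ - p))
    lemma₀ : ∀ x → + 4 * (0ℤ + x) ≡ + 4 * x
    lemma₀ = solve-∀
    lemma₁ : ∀ m p x → ((m + 1ℤ) * (m + 1ℤ) + + 2 * (m + 1ℤ) * (1ℤ - p) + (1ℤ - p) * (1ℤ - p)) * m
                       + - (+ 4 * (m + 1ℤ) * (1ℤ - p)) * x
      ≡ ((m + 1ℤ) * (m + 1ℤ) + + 2 * (m + 1ℤ) * (1ℤ - p) + (1ℤ - p) * (1ℤ - p)) * m
                       - + 2 * (m + 1ℤ) * (1ℤ - p) * (+ 2 * x)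
    lemma₁ = solve-∀
    lemma₂ : ∀ m p → ((m + 1ℤ) * (m + 1ℤ) + + 2 * (m + 1ℤ) * (1ℤ - p) + (1ℤ - p) * (1ℤ - p)) * m
                       - + 2 * (m + 1ℤ) * (1ℤ - p) * (m - p)
      ≡ m * (m + 1ℤ) * (m + 1ℤ) + (1ℤ - p) * m + (p * p - p) * (- m - + 2)
    lemma₂ = solve-∀
    lemma₃ : ∀ m p → m * (m + 1ℤ) * (m + 1ℤ) + (1ℤ - p) * m + (p - p) * (- m - + 2)
      ≡ m * (m + 1ℤ) * (m + 1ℤ) + (1ℤ - p) * m
    lemma₃ = solve-∀
    lemma₄ : ∀ s → + 4 * ((1ℤ + s) * (1ℤ + s)) ≡ (+ 2 + + 2 * s) * (+ 2 + + 2 * s)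
    lemma₄ = solve-∀
    lemma₅ : ∀ m p q → (+ 2 + (m - 1ℤ + (1ℤ - p) * (1ℤ - + 2 * q))) * (+ 2 + (m - 1ℤ + (1ℤ - p) * (1ℤ - + 2 * q)))
      ≡ ((m + 1ℤ) * (m + 1ℤ) + + 2 * (m + 1ℤ) * (1ℤ - p) + (1ℤ - p) * (1ℤ - p)) * 1ℤ
        + - (+ 4 * (m + 1ℤ) * (1ℤ - p)) * q + + 4 * (1ℤ - p) * (1ℤ - p) * (q * q - q)
    lemma₅ = solve-∀
    lemma₆ : ∀ x c q → x + c * (q - q) ≡ x
    lemma₆ = solve-∀
    term : ∀ i → + 4 * ((1ℤ + s i) * (1ℤ + s i)) ≡ a * 1ℤ + b * q i
    term i = begin
      + 4 * ((1ℤ + s i) * (1ℤ + s i))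
        ≡⟨ lemma₄ (s i) ⟩
      (+ 2 + + 2 * s i) * (+ 2 + + 2 * s i)
        ≡⟨ cong (λ x → (+ 2 + x) * (+ 2 + x)) (balanced-score m i) ⟩
      (+ 2 + (+ m - 1ℤ + (1ℤ - p) * (1ℤ - + 2 * q i))) * (+ 2 + (+ m - 1ℤ + (1ℤ - p) * (1ℤ - + 2 * q i)))
        ≡⟨ lemma₅ (+ m) p (q i) ⟩
      a * 1ℤ + b * q i + + 4 * (1ℤ - p) * (1ℤ - p) * (q i * q i - q i)
        ≡⟨ cong (λ x → a * 1ℤ + b * q i + + 4 * (1ℤ - p) * (1ℤ - p) * (x - q i)) (parity-idem (toℕ i)) ⟩
      a * 1ℤ + b * q i + + 4 * (1ℤ - p) * (1ℤ - p) * (q i - q i)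
        ≡⟨ lemma₆ (a * 1ℤ + b * q i) (+ 4 * (1ℤ - p) * (1ℤ - p)) (q i) ⟩
      a * 1ℤ + b * q i ∎

  -- With n = m + 1 the leading product is n(n-1)(n-2), the upper bound on 24 times the cycle count.
  -- The subtracted term is the loss: 0 for odd m and 3m for even m.
  extremal-C₃ : ∀ m → + 24 * + C₃ (extremal m)
    ≡ + m * (+ m + 1ℤ) * (+ m - 1ℤ) - + 3 * ((1ℤ - parity m) * + m)
  extremal-C₃ m = begin
    + 24 * c
      ≡⟨ lemma₀ c ⟩
    + 2 * (+ 12 * c)
      ≡⟨ cong (+ 2 *_) (Scores.C₃-scores (extremal m) (extremal-isTournament m)) ⟩
    + 2 * (+ suc m * (+ suc m - 1ℤ) * (+ 2 * + suc m - 1ℤ) - + 6 * Q)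
      ≡⟨ cong (λ x → + 2 * (x * (x - 1ℤ) * (+ 2 * x - 1ℤ) - + 6 * Q)) (pos-suc m) ⟩
    + 2 * ((1ℤ + + m) * (1ℤ + + m - 1ℤ) * (+ 2 * (1ℤ + + m) - 1ℤ) - + 6 * Q)
      ≡⟨ lemma₁ (+ m) Q ⟩
    + 2 * ((1ℤ + + m) * + m * (+ 2 * + m + 1ℤ)) - + 3 * (+ 4 * Q)
      ≡⟨ cong (λ x → + 2 * ((1ℤ + + m) * + m * (+ 2 * + m + 1ℤ)) - + 3 * x) (extremal-scoreSquares m) ⟩
    + 2 * ((1ℤ + + m) * + m * (+ 2 * + m + 1ℤ))
      - + 3 * (+ m * (+ m + 1ℤ) * (+ m + 1ℤ) + (1ℤ - parity m) * + m)
      ≡⟨ lemma₂ (+ m) (parity m) ⟩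
    + m * (+ m + 1ℤ) * (+ m - 1ℤ) - + 3 * ((1ℤ - parity m) * + m) ∎
    where
    c Q : ℤ
    c = + C₃ (extremal m)
    Q = scoreSquares (extremal m)
    lemma₀ : ∀ c → + 24 * c ≡ + 2 * (+ 12 * c)
    lemma₀ = solve-∀
    lemma₁ : ∀ m q → + 2 * ((1ℤ + m) * (1ℤ + m - 1ℤ) * (+ 2 * (1ℤ + m) - 1ℤ) - + 6 * q)
      ≡ + 2 * ((1ℤ + m) * m * (+ 2 * m + 1ℤ)) - + 3 * (+ 4 * q)
    lemma₁ = solve-∀
    lemma₂ : ∀ m p → + 2 * ((1ℤ + m) * m * (+ 2 * m + 1ℤ)) - + 3 * (m * (m + 1ℤ) * (m + 1ℤ) + (1ℤ - p) * m)
      ≡ m * (m + 1ℤ) * (m - 1ℤ) - + 3 * ((1ℤ - p) * m)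
    lemma₂ = solve-∀

open Extremal

-- Existence of the maximum by finite search.

module Maximum where

  open import Data.Integer.Base using (_+_; _-_)

  -- Matrices are functions, so a matrix and its decoded copy agree only entrywise; membership in
  -- `𝒮` and the cycle count must be transported along this relation.
  _≗₂_ : ∀ {n} → Matrix n → Matrix n → Set
  M ≗₂ N = ∀ i j → M i j ≡ N i j

  𝒮-cong : ∀ {n} {M N : Matrix n} → M ≗₂ N → 𝒮 n M → 𝒮 n N
  𝒮-cong M≗N (T , det≡0) =
    record { zero-one  = λ i j → Sum.map (trans (sym (M≗N i j))) (trans (sym (M≗N i j))) (zero-one i j)
           ; M+Mᵀ≡J-I = λ i j → trans (sym (cong₂ _+_ (M≗N i j) (M≗N j i))) (M+Mᵀ≡J-I i j) }
    , trans (sym (det-cong M≗N)) det≡0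
    where open IsTournament T

  cyclicTriple-cong : ∀ {n} {M N : Matrix n} → M ≗₂ N → ∀ {t} → CyclicTriple M t → CyclicTriple N t
  cyclicTriple-cong {_} {M} {N} M≗N (i<j<k , cycle) = i<j<k , Sum.map transport transport cycle
    where
    transport : ∀ {i j k} → DirectedCycle M i j k → DirectedCycle N i j k
    transport {i} {j} {k} (ij , jk , ki) =
      trans (sym (M≗N i j)) ij , trans (sym (M≗N j k)) jk , trans (sym (M≗N k i)) ki

  C₃-cong : ∀ {n} {M N : Matrix n} → M ≗₂ N → C₃ M ≡ C₃ N
  C₃-cong {n} {M} {N} M≗N = cong length (filter-≐ (cyclicTriple? M) (cyclicTriple? N)
    (cyclicTriple-cong M≗N , cyclicTriple-cong (λ i j → sym (M≗N i j))) (allTriples n))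

  𝒮? : ∀ {n} → Decidable (𝒮 n)
  𝒮? {n} M = isTournament? ×-dec (det M ℤ.≟ 0ℤ)
    where
    isTournament? : Dec (IsTournament M)
    isTournament? = map′
      (λ (zo , total) → record { zero-one = zo ; M+Mᵀ≡J-I = total })
      (λ T → IsTournament.zero-one T , IsTournament.M+Mᵀ≡J-I T)
      (all? (λ i → all? λ j → M i j ℤ.≟ 0ℤ ⊎-dec M i j ℤ.≟ 1ℤ)
       ×-dec all? (λ i → all? λ j → M i j + M j i ℤ.≟ 1ℤ - I n i j))

  -- A 0-1 matrix is n rows of n bits. Each row is one of 2ⁿ numbers, and the list of rows is again
  -- packed into one number, which makes `any?` applicable.
  Code : ℕ → Set
  Code n = Fin ((2 ℕ.^ n) ℕ.^ n)

  decode : ∀ n → Code n → Matrix n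
  decode n c i j = + toℕ (finToFun {2} {n} (finToFun {2 ℕ.^ n} {n} c i) j)

  decode-surjective : ∀ {n} (M : Matrix n) → (∀ i j → M i j ≡ 0ℤ ⊎ M i j ≡ 1ℤ) →
                      Σ[ c ∈ Code n ] M ≗₂ decode n c
  decode-surjective {n} M zo = funToFin rows , λ i j → sym (begin
    + toℕ (finToFun {2} {n} (finToFun {2 ℕ.^ n} {n} (funToFin rows) i) j)
      ≡⟨ cong (λ r → + toℕ (finToFun {2} {n} r j)) (finToFun-funToFin rows i) ⟩
    + toℕ (finToFun {2} {n} (rows i) j)
      ≡⟨ cong (λ b → + toℕ b) (finToFun-funToFin (λ j → bit (zo i j)) j) ⟩
    + toℕ (bit (zo i j))
      ≡⟨ bit-correct (zo i j) ⟩
    M i j ∎)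
    where
    bit : ∀ {x} → x ≡ 0ℤ ⊎ x ≡ 1ℤ → Fin 2
    bit (inj₁ _) = zero
    bit (inj₂ _) = suc zero
    bit-correct : ∀ {x} (z : x ≡ 0ℤ ⊎ x ≡ 1ℤ) → + toℕ (bit z) ≡ x
    bit-correct (inj₁ eq) = sym eq
    bit-correct (inj₂ eq) = sym eq
    rows : Fin n → Fin (2 ℕ.^ n)
    rows i = funToFin (λ j → bit (zo i j))

  -- Search downwards from the bound: a failing `b` lowers the bound by one. The search cannot fail
  -- at 0, since there the known witness is forced to be 0 itself.
  bounded-max : {P : ℕ → Set} → Decidable P → ∀ b {a} → P a → (∀ {k} → P k → k ℕ.≤ b) →
                ∃[ m ] P m × (∀ {k} → P k → k ℕ.≤ m)
  bounded-max P? b Pa bound with P? b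
  ... | yes Pb = b , Pb , bound
  bounded-max {P} P? zero    Pa bound | no ¬P₀ = ⊥-elim (¬P₀ (subst P (ℕ.n≤0⇒n≡0 (bound Pa)) Pa))
  bounded-max {P} P? (suc b) Pa bound | no ¬Pb = bounded-max P? b Pa λ {k} Pk →
    ℕ.s≤s⁻¹ (ℕ.≤∧≢⇒< (bound Pk) (λ { refl → ¬Pb Pk }))

  -- The finite, hence decidable, counterpart of being the cycle count of some matrix in `𝒮 n`.
  Attained : ℕ → ℕ → Set
  Attained n m = Σ[ c ∈ Code n ] 𝒮 n (decode n c) × C₃ (decode n c) ≡ m

  attained? : ∀ n → Decidable (Attained n)
  attained? n m = any? λ c → 𝒮? (decode n c) ×-dec (C₃ (decode n c) ℕ.≟ m)

  𝒮⇒attained : ∀ {n} (M : Matrix n) → 𝒮 n M → Attained n (C₃ M)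
  𝒮⇒attained {n} M M∈𝒮 =
    let c , M≗c = decode-surjective M (IsTournament.zero-one (proj₁ M∈𝒮))
    in c , 𝒮-cong M≗c M∈𝒮 , sym (C₃-cong M≗c)

  maxC₃-exists : ∀ {n} (M : Matrix n) → 𝒮 n M → ∃[ m ] IsMaxC₃ n m
  maxC₃-exists {n} M M∈𝒮 =
    let m , (c , c∈𝒮 , C₃≡m) , maximal =
          bounded-max (attained? n) (length (allTriples n)) (𝒮⇒attained M M∈𝒮) bound
    in m , (decode n c , c∈𝒮 , C₃≡m) , λ N N∈𝒮 → maximal (𝒮⇒attained N N∈𝒮)
    where
    bound : ∀ {k} → Attained n k → k ℕ.≤ length (allTriples n)
    bound (c , _ , refl) = length-filter (cyclicTriple? (decode n c)) (allTriples n)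

open Maximum

-- Binomial coefficients, rational quarters and the split by parity.

import Data.Rational.Properties as ℚ
import Data.Rational.Unnormalised.Base as ℚᵘ
import Data.Rational.Unnormalised.Properties as ℚᵘ
open import Data.Nat.Base using (_≤_; _+_; _*_; _/_)
open import Data.Nat.Combinatorics using (_C_; nC1≡n; nCk+nC[k+1]≡[n+1]C[k+1])
open import Data.Nat.Divisibility using (_∣_; n∣m*n; ∣m+n∣m⇒∣n; ∣1⇒≡1)
open import Data.Nat.DivMod using (m*n/n≡m)
open import Data.Rational.Base using (toℚᵘ) renaming (_/_ to _/ℚ_; _≤_ to _≤ℚ_; _*_ to _*ℚ_)

2*nC2 : ∀ n → + 2 ℤ.* + (n C 2) ≡ + n ℤ.* (+ n ℤ.- 1ℤ)
2*nC2 zero    = refl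
2*nC2 (suc n) = begin
  + 2 ℤ.* + (suc n C 2)              ≡⟨ cong (λ x → + 2 ℤ.* + x) (nCk+nC[k+1]≡[n+1]C[k+1] n 1) ⟨
  + 2 ℤ.* + (n C 1 + n C 2)          ≡⟨ cong (λ x → + 2 ℤ.* + (x + n C 2)) (nC1≡n n) ⟩
  + 2 ℤ.* + (n + n C 2)              ≡⟨ cong (+ 2 ℤ.*_) (ℤ.pos-+ n (n C 2)) ⟩
  + 2 ℤ.* (+ n ℤ.+ + (n C 2))        ≡⟨ lemma₁ (+ n) (+ (n C 2)) ⟩
  + 2 ℤ.* + n ℤ.+ + 2 ℤ.* + (n C 2)  ≡⟨ cong (λ x → + 2 ℤ.* + n ℤ.+ x) (2*nC2 n) ⟩
  + 2 ℤ.* + n ℤ.+ + n ℤ.* (+ n ℤ.- 1ℤ) ≡⟨ lemma₂ (+ n) ⟩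
  (1ℤ ℤ.+ + n) ℤ.* (1ℤ ℤ.+ + n ℤ.- 1ℤ) ≡⟨ cong (λ x → x ℤ.* (x ℤ.- 1ℤ)) (pos-suc n) ⟨
  + suc n ℤ.* (+ suc n ℤ.- 1ℤ)       ∎
  where
  lemma₁ : ∀ x y → + 2 ℤ.* (x ℤ.+ y) ≡ + 2 ℤ.* x ℤ.+ + 2 ℤ.* y
  lemma₁ = solve-∀
  lemma₂ : ∀ x → + 2 ℤ.* x ℤ.+ x ℤ.* (x ℤ.- 1ℤ) ≡ (1ℤ ℤ.+ x) ℤ.* (1ℤ ℤ.+ x ℤ.- 1ℤ)
  lemma₂ = solve-∀

-- Over ℤ the differences are not truncated. For n < 3 one factor is zero, in agreement with the
-- vanishing binomial.
6*nC3 : ∀ n → + 6 ℤ.* + (n C 3) ≡ + n ℤ.* (+ n ℤ.- 1ℤ) ℤ.* (+ n ℤ.- + 2)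
6*nC3 zero    = refl
6*nC3 (suc n) = begin
  + 6 ℤ.* + (suc n C 3)              ≡⟨ cong (λ x → + 6 ℤ.* + x) (nCk+nC[k+1]≡[n+1]C[k+1] n 2) ⟨
  + 6 ℤ.* + (n C 2 + n C 3)          ≡⟨ cong (+ 6 ℤ.*_) (ℤ.pos-+ (n C 2) (n C 3)) ⟩
  + 6 ℤ.* (+ (n C 2) ℤ.+ + (n C 3))  ≡⟨ lemma₁ (+ (n C 2)) (+ (n C 3)) ⟩
  + 3 ℤ.* (+ 2 ℤ.* + (n C 2)) ℤ.+ + 6 ℤ.* + (n C 3)
    ≡⟨ cong₂ (λ x y → + 3 ℤ.* x ℤ.+ y) (2*nC2 n) (6*nC3 n) ⟩
  + 3 ℤ.* (+ n ℤ.* (+ n ℤ.- 1ℤ)) ℤ.+ + n ℤ.* (+ n ℤ.- 1ℤ) ℤ.* (+ n ℤ.- + 2)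
    ≡⟨ lemma₂ (+ n) ⟩
  (1ℤ ℤ.+ + n) ℤ.* (1ℤ ℤ.+ + n ℤ.- 1ℤ) ℤ.* (1ℤ ℤ.+ + n ℤ.- + 2)
    ≡⟨ cong (λ x → x ℤ.* (x ℤ.- 1ℤ) ℤ.* (x ℤ.- + 2)) (pos-suc n) ⟨
  + suc n ℤ.* (+ suc n ℤ.- 1ℤ) ℤ.* (+ suc n ℤ.- + 2) ∎
  where
  lemma₁ : ∀ x y → + 6 ℤ.* (x ℤ.+ y) ≡ + 3 ℤ.* (+ 2 ℤ.* x) ℤ.+ + 6 ℤ.* y
  lemma₁ = solve-∀
  lemma₂ : ∀ x → + 3 ℤ.* (x ℤ.* (x ℤ.- 1ℤ)) ℤ.+ x ℤ.* (x ℤ.- 1ℤ) ℤ.* (x ℤ.- + 2)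
    ≡ (1ℤ ℤ.+ x) ℤ.* (1ℤ ℤ.+ x ℤ.- 1ℤ) ℤ.* (1ℤ ℤ.+ x ℤ.- + 2)
  lemma₂ = solve-∀

4*C₃≤nC3 : ∀ {n} (M : Matrix n) → 𝒮 n M → 4 * C₃ M ≤ n C 3
4*C₃≤nC3 {n} M (T , det≡0) = ℤ.drop‿+≤+ (ℤ.*-cancelˡ-≤-pos (+ (4 * C₃ M)) (+ (n C 3)) (+ 6)
  (ℤ.≤-trans (ℤ.≤-reflexive (begin
    + 6 ℤ.* + (4 * C₃ M)       ≡⟨ cong (+ 6 ℤ.*_) (ℤ.pos-* 4 (C₃ M)) ⟩
    + 6 ℤ.* (+ 4 ℤ.* + C₃ M)   ≡⟨ ℤ.*-assoc (+ 6) (+ 4) (+ C₃ M) ⟨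
    + 24 ℤ.* + C₃ M            ∎))
  (ℤ.≤-trans (Scores.singular⇒C₃-bound M T det≡0) (ℤ.≤-reflexive (sym (6*nC3 n))))))

extremal-C₃-even : ∀ k → 4 * C₃ (extremal (suc (k * 2))) ≡ suc (suc (k * 2)) C 3
extremal-C₃-even k = ℤ.+-injective (ℤ.*-cancelˡ-≡ (+ 6) (+ (4 * c)) (+ (suc (suc m) C 3)) (begin
  + 6 ℤ.* + (4 * c)       ≡⟨ cong (+ 6 ℤ.*_) (ℤ.pos-* 4 c) ⟩
  + 6 ℤ.* (+ 4 ℤ.* + c)   ≡⟨ ℤ.*-assoc (+ 6) (+ 4) (+ c) ⟨
  + 24 ℤ.* + c            ≡⟨ extremal-C₃ (suc m) ⟩
  + suc m ℤ.* (+ suc m ℤ.+ 1ℤ) ℤ.* (+ suc m ℤ.- 1ℤ) ℤ.- + 3 ℤ.* ((1ℤ ℤ.- (1ℤ ℤ.- parity m)) ℤ.* + suc m)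
    ≡⟨ cong (λ p → + suc m ℤ.* (+ suc m ℤ.+ 1ℤ) ℤ.* (+ suc m ℤ.- 1ℤ) ℤ.- + 3 ℤ.* ((1ℤ ℤ.- (1ℤ ℤ.- p)) ℤ.* + suc m)) (parity-2* k) ⟩
  + suc m ℤ.* (+ suc m ℤ.+ 1ℤ) ℤ.* (+ suc m ℤ.- 1ℤ) ℤ.- + 3 ℤ.* ((1ℤ ℤ.- (1ℤ ℤ.- 0ℤ)) ℤ.* + suc m)
    ≡⟨ lemma (+ suc m) ⟩
  (1ℤ ℤ.+ + suc m) ℤ.* (1ℤ ℤ.+ + suc m ℤ.- 1ℤ) ℤ.* (1ℤ ℤ.+ + suc m ℤ.- + 2)
    ≡⟨ cong (λ x → x ℤ.* (x ℤ.- 1ℤ) ℤ.* (x ℤ.- + 2)) (pos-suc (suc m)) ⟨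
  + suc (suc m) ℤ.* (+ suc (suc m) ℤ.- 1ℤ) ℤ.* (+ suc (suc m) ℤ.- + 2)
    ≡⟨ 6*nC3 (suc (suc m)) ⟨
  + 6 ℤ.* + (suc (suc m) C 3) ∎))
  where
  m c : ℕ
  m = k * 2
  c = C₃ (extremal (suc m))
  lemma : ∀ x → x ℤ.* (x ℤ.+ 1ℤ) ℤ.* (x ℤ.- 1ℤ) ℤ.- + 3 ℤ.* ((1ℤ ℤ.- (1ℤ ℤ.- 0ℤ)) ℤ.* x)
    ≡ (1ℤ ℤ.+ x) ℤ.* (1ℤ ℤ.+ x ℤ.- 1ℤ) ℤ.* (1ℤ ℤ.+ x ℤ.- + 2)
  lemma = solve-∀

-- For m = 2k the count from `extremal-C₃` becomes m(m² - 4) = 8(k + 1)k(k - 1), which is 48 times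
-- the binomial.
extremal-C₃-odd : ∀ k → C₃ (extremal (k * 2)) ≡ 2 * (suc k C 3)
extremal-C₃-odd k = ℤ.+-injective (ℤ.*-cancelˡ-≡ (+ 24) (+ c) (+ (2 * (suc k C 3))) (begin
  + 24 ℤ.* + c            ≡⟨ extremal-C₃ m ⟩
  + m ℤ.* (+ m ℤ.+ 1ℤ) ℤ.* (+ m ℤ.- 1ℤ) ℤ.- + 3 ℤ.* ((1ℤ ℤ.- parity m) ℤ.* + m)
    ≡⟨ cong₂ (λ x p → x ℤ.* (x ℤ.+ 1ℤ) ℤ.* (x ℤ.- 1ℤ) ℤ.- + 3 ℤ.* ((1ℤ ℤ.- p) ℤ.* x))
         (ℤ.pos-* k 2) (parity-2* k) ⟩
  + k ℤ.* + 2 ℤ.* (+ k ℤ.* + 2 ℤ.+ 1ℤ) ℤ.* (+ k ℤ.* + 2 ℤ.- 1ℤ) ℤ.- + 3 ℤ.* ((1ℤ ℤ.- 0ℤ) ℤ.* (+ k ℤ.* + 2))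
    ≡⟨ lemma₁ (+ k) ⟩
  + 8 ℤ.* ((1ℤ ℤ.+ + k) ℤ.* (1ℤ ℤ.+ + k ℤ.- 1ℤ) ℤ.* (1ℤ ℤ.+ + k ℤ.- + 2))
    ≡⟨ cong (λ x → + 8 ℤ.* (x ℤ.* (x ℤ.- 1ℤ) ℤ.* (x ℤ.- + 2))) (pos-suc k) ⟨
  + 8 ℤ.* (+ suc k ℤ.* (+ suc k ℤ.- 1ℤ) ℤ.* (+ suc k ℤ.- + 2))
    ≡⟨ cong (+ 8 ℤ.*_) (6*nC3 (suc k)) ⟨
  + 8 ℤ.* (+ 6 ℤ.* + (suc k C 3))
    ≡⟨ lemma₂ (+ (suc k C 3)) ⟩
  + 24 ℤ.* (+ 2 ℤ.* + (suc k C 3))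
    ≡⟨ cong (+ 24 ℤ.*_) (ℤ.pos-* 2 (suc k C 3)) ⟨
  + 24 ℤ.* + (2 * (suc k C 3)) ∎))
  where
  m c : ℕ
  m = k * 2
  c = C₃ (extremal m)
  lemma₁ : ∀ k → k ℤ.* + 2 ℤ.* (k ℤ.* + 2 ℤ.+ 1ℤ) ℤ.* (k ℤ.* + 2 ℤ.- 1ℤ) ℤ.- + 3 ℤ.* ((1ℤ ℤ.- 0ℤ) ℤ.* (k ℤ.* + 2))
    ≡ + 8 ℤ.* ((1ℤ ℤ.+ k) ℤ.* (1ℤ ℤ.+ k ℤ.- 1ℤ) ℤ.* (1ℤ ℤ.+ k ℤ.- + 2))
  lemma₁ = solve-∀
  lemma₂ : ∀ x → + 8 ℤ.* (+ 6 ℤ.* x) ≡ + 24 ℤ.* (+ 2 ℤ.* x)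
  lemma₂ = solve-∀

-- Normalised fractions involve a gcd that does not reduce for a variable `c`, so comparison takes
-- place among unnormalised ones. Their denominator is stored minus one: the 3 stands for 4.
toℚᵘ-quarter : ∀ c → toℚᵘ (((+ 1) /ℚ 4) *ℚ ((+ c) /ℚ 1)) ℚᵘ.≃ ℚᵘ.mkℚᵘ (+ c) 3
toℚᵘ-quarter c = ℚᵘ.≃-trans (ℚ.toℚᵘ-homo-* ((+ 1) /ℚ 4) ((+ c) /ℚ 1))
  (ℚᵘ.≃-trans (ℚᵘ.*-cong (ℚ.toℚᵘ-fromℚᵘ (ℚᵘ.mkℚᵘ (+ 1) 3)) (ℚ.toℚᵘ-fromℚᵘ (ℚᵘ.mkℚᵘ (+ c) 0)))
    (ℚᵘ.*≡* (cong (ℤ._* + 4) (ℤ.*-identityˡ (+ c)))))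

quarter-≡ : ∀ m c → 4 * m ≡ c → (+ m) /ℚ 1 ≡ ((+ 1) /ℚ 4) *ℚ ((+ c) /ℚ 1)
quarter-≡ m c 4m≡c = ℚ.toℚᵘ-injective
  (ℚᵘ.≃-trans (ℚ.toℚᵘ-fromℚᵘ (ℚᵘ.mkℚᵘ (+ m) 0))
    (ℚᵘ.≃-trans (ℚᵘ.*≡* eq) (ℚᵘ.≃-sym (toℚᵘ-quarter c))))
  where
  eq : + m ℤ.* + 4 ≡ + c ℤ.* + 1
  eq = begin
    + m ℤ.* + 4  ≡⟨ ℤ.*-comm (+ m) (+ 4) ⟩
    + 4 ℤ.* + m  ≡⟨ ℤ.pos-* 4 m ⟨
    + (4 * m)    ≡⟨ cong +_ 4m≡c ⟩
    + c          ≡⟨ ℤ.*-identityʳ (+ c) ⟨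
    + c ℤ.* + 1  ∎

quarter-≤ : ∀ m c → 4 * m ≤ c → (+ m) /ℚ 1 ≤ℚ ((+ 1) /ℚ 4) *ℚ ((+ c) /ℚ 1)
quarter-≤ m c 4m≤c = ℚ.toℚᵘ-cancel-≤
  (ℚᵘ.≤-trans (ℚᵘ.≤-reflexive (ℚ.toℚᵘ-fromℚᵘ (ℚᵘ.mkℚᵘ (+ m) 0)))
    (ℚᵘ.≤-trans (ℚᵘ.*≤* le) (ℚᵘ.≤-reflexive (ℚᵘ.≃-sym (toℚᵘ-quarter c)))))
  where
  le : + m ℤ.* + 4 ℤ.≤ + c ℤ.* + 1
  le = ℤ.≤-trans (ℤ.≤-reflexive (trans (ℤ.*-comm (+ m) (+ 4)) (sym (ℤ.pos-* 4 m))))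
    (ℤ.≤-trans (ℤ.+≤+ 4m≤c) (ℤ.≤-reflexive (sym (ℤ.*-identityʳ (+ c)))))

even-or-odd : ∀ m → ∃[ k ] (m ≡ k * 2 ⊎ m ≡ suc (k * 2))
even-or-odd zero    = 0 , inj₁ refl
even-or-odd (suc m) with even-or-odd m
... | k , inj₁ refl = k , inj₂ refl
... | k , inj₂ refl = suc k , inj₁ refl

odd⇒2∤ : ∀ k → ¬ (2 ∣ suc (k * 2))
-- As 2 divides k * 2, it would also divide the remaining summand 1.
odd⇒2∤ k 2∣ with () ← ∣1⇒≡1 (∣m+n∣m⇒∣n (subst (2 ∣_) (ℕ.+-comm 1 (k * 2)) 2∣) (n∣m*n k))

half : ∀ k → (suc (k * 2) + 1) / 2 ≡ suc k
half k = trans (cong (_/ 2) (ℕ.+-comm (suc (k * 2)) 1)) (m*n/n≡m (suc k) 2)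

max⇒4*m≤nC3 : ∀ {n m} → IsMaxC₃ n m → 4 * m ≤ n C 3
max⇒4*m≤nC3 {n} ((M , M∈𝒮 , C₃≡m) , _) = subst (λ m → 4 * m ≤ n C 3) C₃≡m (4*C₃≤nC3 M M∈𝒮)

max-even : ∀ {m} k → IsMaxC₃ (suc (suc (k * 2))) m → 4 * m ≡ suc (suc (k * 2)) C 3
max-even k isMax@(_ , maximal) = ℕ.≤-antisym (max⇒4*m≤nC3 isMax)
  (ℕ.≤-trans (ℕ.≤-reflexive (sym (extremal-C₃-even k)))
    (ℕ.*-monoʳ-≤ 4 (maximal (extremal (suc (k * 2))) (extremal∈𝒮 (suc (k * 2))))))

max-odd : ∀ {m} k → IsMaxC₃ (suc (k * 2)) m → 2 * (((suc (k * 2) + 1) / 2) C 3) ≤ m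
max-odd {m} k (_ , maximal) = subst (λ h → 2 * (h C 3) ≤ m) (sym (half k))
  (ℕ.≤-trans (ℕ.≤-reflexive (sym (extremal-C₃-odd k)))
    (maximal (extremal (k * 2)) (extremal∈𝒮 (k * 2))))

max-bounds : ∀ {m} l → IsMaxC₃ (suc l) m →
  (2 ∣ suc l → 4 * m ≡ suc l C 3) × (¬ (2 ∣ suc l) → 2 * (((suc l + 1) / 2) C 3) ≤ m)
max-bounds l isMax with even-or-odd l
-- The order is l + 1, so an even `l` gives the odd case of the theorem and an odd `l` the even one.
... | k , inj₁ refl = (λ 2∣n → ⊥-elim (odd⇒2∤ k 2∣n)) , λ _ → max-odd k isMax
... | k , inj₂ refl = (λ _ → max-even k isMax) , λ 2∤n → ⊥-elim (2∤n (n∣m*n (suc k)))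

proposition2p4 : ∀ (n : ℕ) → 1 ≤ n →
    ∃[ m ] IsMaxC₃ n m
    × (2 ∣ n → (+ m) /ℚ 1 ≡ ((+ 1) /ℚ 4) *ℚ ((+ (n C 3)) /ℚ 1))
    × (¬ (2 ∣ n) → 2 * (((n + 1) / 2) C 3) ≤ m
    × (+ m) /ℚ 1 ≤ℚ ((+ 1) /ℚ 4) *ℚ ((+ (n C 3)) /ℚ 1))
proposition2p4 n@(suc l) _ =
  let m , isMax  = maxC₃-exists (extremal l) (extremal∈𝒮 l)
      even , odd = max-bounds l isMax
  in m , isMax
   , (λ 2∣n → quarter-≡ m (n C 3) (even 2∣n))
   , λ 2∤n → odd 2∤n , quarter-≤ m (n C 3) (max⇒4*m≤nC3 isMax)
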